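{- Let $M$ be a matroid with hyperplane incidence graph $G_M$. Fix an arbitrary spanning forest $F$ of $G_M$, let $S=E(G_M)\setminus E(F)$ be the set of edges of $G_M$ not in $F$, and let $T$ be the set consisting of all relations (T1) and (T2) described in the context. Then for every pasture $P$ there is a bijection $$\mathrm{R}_M(P)\ \longrightarrow\ \{\text{pasture morphisms } \mathbb{F}_1^{\pm}(x_i\mid i\in S)/\!\!/\langle T\rangle\to P\}$$ which is functorial in $P$.
   Context: **Pastures.** A pointed group is a multiplicatively written commutative monoid $P$ with neutral element $1$ and absorbing element $0\ne1$ in which every nonzero element is invertible; $P^\times=P\setminus\{0\}$. In $\mathrm{Sym}^3(P)=P^3/S_3$ write $a+b+c$ for the class of $(a,b,c)$, $a+b$ for $a+b+0$ and $a$ for $a+0+0$. A pasture is a pointed group $P$ with a subset $N_P\subseteq\mathrm{Sym}^3(P)$ (the null set) that is invariant under multiplication by elements of $P$ and such that for every $a\in P$ there is a unique $b\in P$, denoted $-a$, with $a+b\in N_P$. A pasture morphism $g:P\to Q$ is a multiplicative map preserving $0$ and $1$ with $g(a)+g(b)+g(c)\in N_Q$ whenever $a+b+c\in N_P$. The free algebra $\mathbb F_1^\pm(x_1,\dots,x_n)=\{0\}\cup\{\pm x_1^{e_1}\cdots x_n^{e_n}\mid e_i\in\mathbb Z\}$ has null set $\{a-a\}$ for $a$ in it. For a subset $T$ of $\mathrm{Sym}^3$ of it containing no $a+0+0$ with $a\neq0$, the quotient $\mathbb F_1^\pm(x_1,\dots,x_n)/\!\!/\langle T\rangle$ is the pasture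 characterized by: morphisms to a pasture $Q$ correspond functorially to maps $g:\{x_1,\dots,x_n\}\to Q^\times$ such that the induced morphism $\Phi(g):\mathbb F_1^\pm(x_1,\dots,x_n)\to Q$ satisfies $\Phi(g)(a)+\Phi(g)(b)+\Phi(g)(c)\in N_Q$ for all $a+b+c\in T$. **Representations.** Let $M$ be a matroid on a finite set $E$ with set of hyperplanes $\mathcal H$. A family of $P$-hyperplane functions for $M$ is a family $\varphi=(\varphi_H:E\to P)_{H\in\mathcal H}$ with $\varphi_H(e)=0$ iff $e\in H$. A modular tuple of hyperplanes is a tuple of hyperplanes whose intersection is a corank $2$ flat. A $P$-representation of $M$ is a family of $P$-hyperplane functions such that for every modular triple $(H_1,H_2,H_3)$ of distinct hyperplanes there is $(a,b,c)\in P^3\setminus\{(0,0,0)\}$ with $a\varphi_{H_1}(e)+b\varphi_{H_2}(e)+c\varphi_{H_3}(e)\in N_P$ for all $e\in E$. Families $\varphi,\varphi'$ are rescaling equivalent if $\varphi'_H(e)=a_Ht_e\varphi_H(e)$ for some $(a_H)\in(P^\times)^{\mathcal H}$, $(t_e)\in(P^\times)^E$. $\mathrm R_M(P)$ is the set of rescaling classes of $P$-representations of $M$; it is a functor in $P$ by composing hyperplane functions with pasture morphisms. **Graph and relations.** The hyperplane incidence graph $G_M$ is the bipartite graph with vertex set $\mathcal H\sqcup E$ in which $H\in\mathcal H$ and $e\in E$ are adjacent iff $e\notin H$. A spanning forest is a maximal set of edges containing no cycle. For an edge $(H,e)$ of $G_M$ let $x_{H,e}$ be the corresponding indeterminate if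 $(H,e)\in S$, and $x_{H,e}=1$ if $(H,e)\in F$. The relations are: (T1) for every modular triple $(H_1,H_2,H_3)$ of distinct hyperplanes with $L=H_1\cap H_2\cap H_3$ and all $a_i\in H_i-L$: $$\frac{x_{H_1,a_2}x_{H_2,a_3}x_{H_3,a_1}}{x_{H_1,a_3}x_{H_2,a_1}x_{H_3,a_2}}+1;$$ (T2) for every modular quadruple $(H_1,H_2,H_3,H_4)$ of distinct hyperplanes with $L=H_1\cap H_2\cap H_3\cap H_4$ and all $a_i\in H_i-L$: $$\frac{x_{H_1,a_3}x_{H_2,a_4}}{x_{H_1,a_4}x_{H_2,a_3}}+\frac{x_{H_1,a_2}x_{H_3,a_4}}{x_{H_1,a_4}x_{H_3,a_2}}-1.$$ -}

module Defs where

open import Algebra.Bundles using (AbelianGroup; CommutativeMonoid)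
open import Algebra.Definitions using (Zero)
open import Algebra.Morphism.Structures using (module MonoidMorphisms)
open import Algebra.Structures using (IsCommutativeMonoid)
import Algebra.Properties.AbelianGroup as AbelianGroupProperties
import Algebra.Properties.CommutativeSemigroup as CommutativeSemigroupProperties
import Algebra.Properties.Monoid.Mult as Mult
import Data.Bool as Bool
open import Data.Fin using (Fin; zero; suc)
import Data.Fin.Properties as Fin
open import Data.Fin.Subset using (Subset; inside; outside; _∈_; _∉_; _⊆_; _∪_; _∩_; _─_; ⋂; ⊤; ⁅_⁆; ∣_∣)
import Data.Fin.Subset.Properties as Subset
open import Data.Integer using (ℤ; +_; -[1+_]; 0ℤ; 1ℤ)
import Data.Integer as ℤ
import Data.Integer.Properties as ℤ
open import Data.List using (List; []; _∷_; _++_; map; length; mapMaybe; filter; cartesianProduct; allFin)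
import Data.List.Membership.DecPropositional as DecMembership
open import Data.List.Relation.Unary.Any using (index)
open import Data.List.Relation.Unary.Linked using (Linked)
open import Data.List.Relation.Unary.Unique.Propositional using (Unique)
import Data.Maybe as Maybe
open import Data.Nat using (ℕ; zero; suc; _+_; _≤_; _<_; _≥_)
import Data.Nat.Properties as ℕ
open import Data.Product using (Σ; Σ-syntax; ∃; ∃!; ∃-syntax; _×_; _,_; proj₁; proj₂)
open import Data.Product.Properties using (≡-dec)
open import Data.Sign using (Sign)
import Data.Sign as Sign
import Data.Sign.Properties as Sign
open import Data.Sum using (_⊎_; inj₁; inj₂)
open import Data.Vec using (Vec; []; _∷_; _[_]≔_; replicate; zipWith)
import Data.Vec as Vec
import Data.Vec.Properties as Vec
open import Function using (_∘_)
open import Function.Bundles using (_⇔_; mk⇔; module Equivalence; Bijection)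
open import Level using (Level; 0ℓ; _⊔_) renaming (suc to lsuc)
open import Relation.Binary using (Setoid; IsEquivalence; Rel; DecidableEquality)
open import Relation.Binary.Construct.Closure.Equivalence using (EqClosure)
import Relation.Binary.Construct.Closure.Equivalence as EqC
open import Relation.Binary.Construct.Closure.ReflexiveTransitive using (ε; _◅_)
open import Relation.Binary.Construct.Closure.Symmetric using (fwd; bwd)
open import Relation.Binary.PropositionalEquality using (_≡_; _≢_; refl; cong; cong₂; isEquivalence)
import Relation.Binary.PropositionalEquality as ≡
import Relation.Binary.Reasoning.Setoid as SetoidReasoning
open import Relation.Nullary using (¬_; Dec; yes; no; contradiction)
open import Relation.Nullary.Decidable using (dec⇒maybe; decidable-stable; map′; _×-dec_; _→-dec_; ¬?)
open import Relation.Unary using (Pred; Decidable) renaming (_⊆_ to _⊆ᴾ_; _∈_ to _∈ᴾ_)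

private
  variable
    c ℓ ν c′ ℓ′ ν′ c″ ℓ″ ν″ : Level
    k n : ℕ

-- A subset of Sym³(P) is a ternary predicate invariant under the two
-- transpositions generating S₃.
record Pasture c ℓ ν : Set (lsuc (c ⊔ ℓ ⊔ ν)) where
  infix  4 _≈_ _≉_
  infixl 7 _*_
  field
    Carrier             : Set c
    _≈_                 : Rel Carrier ℓ
    _*_                 : Carrier → Carrier → Carrier
    0# 1#               : Carrier
    isCommutativeMonoid : IsCommutativeMonoid _≈_ _*_ 1#
    *-zero              : Zero _≈_ 0# _*_
    0≉1                 : ¬ 0# ≈ 1#
    invertible          : ∀ {x} → ¬ x ≈ 0# → ∃[ y ] x * y ≈ 1#
    Null                : Carrier → Carrier → Carrier → Set ν
    Null-resp           : ∀ {x x′ y y′ z z′} → x ≈ x′ → y ≈ y′ → z ≈ z′ → Null x y z → Null x′ y′ z′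
    Null-swap₁₂         : ∀ {x y z} → Null x y z → Null y x z
    Null-swap₂₃         : ∀ {x y z} → Null x y z → Null x z y
    Null-*              : ∀ d {x y z} → Null x y z → Null (d * x) (d * y) (d * z)
    negation            : ∀ x → ∃! _≈_ λ y → Null x y 0#

  _≉_ : Rel Carrier ℓ
  x ≉ y = ¬ x ≈ y

  open IsCommutativeMonoid isCommutativeMonoid public
    using (setoid; assoc; comm; identityˡ; identityʳ; ∙-cong; ∙-congˡ; ∙-congʳ)
    renaming (refl to ≈-refl; sym to ≈-sym; trans to ≈-trans; reflexive to ≈-reflexive)

  commutativeMonoid : CommutativeMonoid c ℓ
  commutativeMonoid = record { isCommutativeMonoid = isCommutativeMonoid }

  open CommutativeMonoid commutativeMonoid public using (rawMonoid)

  infix 8 -_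
  -_ : Carrier → Carrier
  - x = proj₁ (negation x)

  -‿null : ∀ x → Null x (- x) 0#
  -‿null x = proj₁ (proj₂ (negation x))

  -‿unique : ∀ {x y} → Null x y 0# → - x ≈ y
  -‿unique = proj₂ (proj₂ (negation _))

  zeroˡ : ∀ x → 0# * x ≈ 0#
  zeroˡ = proj₁ *-zero

  zeroʳ : ∀ x → x * 0# ≈ 0#
  zeroʳ = proj₂ *-zero

  -‿involutive : ∀ x → - (- x) ≈ x
  -‿involutive x = -‿unique (Null-swap₁₂ (-‿null x))

  -‿cong : ∀ {x y} → x ≈ y → - x ≈ - y
  -‿cong x≈y = -‿unique (Null-resp (≈-sym x≈y) ≈-refl ≈-refl (-‿null _))

  *-‿distribʳ : ∀ x y → - (x * y) ≈ x * - y
  *-‿distribʳ x y = -‿unique (Null-resp ≈-refl ≈-refl (zeroʳ x) (Null-* x (-‿null y)))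

  1≉0 : 1# ≉ 0#
  1≉0 = 0≉1 ∘ ≈-sym

  *-nonzero : ∀ {x y} → x ≉ 0# → y ≉ 0# → x * y ≉ 0#
  *-nonzero {x} {y} x≉0 y≉0 xy≈0 with x⁻¹ , xx⁻¹≈1 ← invertible x≉0 = y≉0 (begin
    y              ≈⟨ identityˡ y ⟨
    1# * y         ≈⟨ ∙-congʳ xx⁻¹≈1 ⟨
    x * x⁻¹ * y    ≈⟨ ∙-congʳ (comm x x⁻¹) ⟩
    x⁻¹ * x * y    ≈⟨ assoc x⁻¹ x y ⟩
    x⁻¹ * (x * y)  ≈⟨ ∙-congˡ xy≈0 ⟩
    x⁻¹ * 0#       ≈⟨ zeroʳ x⁻¹ ⟩
    0#             ∎)
    where open SetoidReasoning setoid

  Unit : Set (c ⊔ ℓ)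
  Unit = Σ[ x ∈ Carrier ] x ≉ 0#

  unit⇒nonzero : ∀ {x y} → x * y ≈ 1# → x ≉ 0#
  unit⇒nonzero {y = y} xy≈1 x≈0 = 1≉0 (≈-trans (≈-sym xy≈1) (≈-trans (∙-congʳ x≈0) (zeroˡ y)))

  infix 9 _⁻¹
  _⁻¹ : Unit → Unit
  (x , x≉0) ⁻¹ with y , xy≈1 ← invertible x≉0 = y , unit⇒nonzero (≈-trans (comm y x) xy≈1)

  unitInverseʳ : (u : Unit) → proj₁ u * proj₁ (u ⁻¹) ≈ 1#
  unitInverseʳ (x , x≉0) = proj₂ (invertible x≉0)

  unitGroup : AbelianGroup (c ⊔ ℓ) ℓ
  unitGroup = record
    { Carrier = Unit
    ; _≈_ = λ u v → proj₁ u ≈ proj₁ v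
    ; _∙_ = λ u v → proj₁ u * proj₁ v , *-nonzero (proj₂ u) (proj₂ v)
    ; ε = 1# , 1≉0
    ; _⁻¹ = _⁻¹
    ; isAbelianGroup = record
      { isGroup = record
        { isMonoid = record
          { isSemigroup = record
            { isMagma = record
              { isEquivalence = record { refl = ≈-refl ; sym = ≈-sym ; trans = ≈-trans }
              ; ∙-cong = ∙-cong }
            ; assoc = λ u v w → assoc _ _ _ }
          ; identity = (λ u → identityˡ _) , (λ u → identityʳ _) }
        ; inverse = (λ u → ≈-trans (comm _ _) (unitInverseʳ u)) , unitInverseʳ
        ; ⁻¹-cong = λ {u} {v} u≈v → begin
            proj₁ (u ⁻¹)                              ≈⟨ identityʳ _ ⟨
            proj₁ (u ⁻¹) * 1#                         ≈⟨ ∙-congˡ (unitInverseʳ v) ⟨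
            proj₁ (u ⁻¹) * (proj₁ v * proj₁ (v ⁻¹))   ≈⟨ assoc _ _ _ ⟨
            proj₁ (u ⁻¹) * proj₁ v * proj₁ (v ⁻¹)     ≈⟨ ∙-congʳ (∙-congˡ u≈v) ⟨
            proj₁ (u ⁻¹) * proj₁ u * proj₁ (v ⁻¹)     ≈⟨ ∙-congʳ (≈-trans (comm _ _) (unitInverseʳ u)) ⟩
            1# * proj₁ (v ⁻¹)                         ≈⟨ identityˡ _ ⟩
            proj₁ (v ⁻¹)                              ∎ }
      ; comm = λ u v → comm _ _ } }
    where open SetoidReasoning setoid

record Morphism (P : Pasture c ℓ ν) (Q : Pasture c′ ℓ′ ν′) : Set (c ⊔ ℓ ⊔ ν ⊔ c′ ⊔ ℓ′ ⊔ ν′) where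
  private
    module P = Pasture P
    module Q = Pasture Q
  open MonoidMorphisms P.rawMonoid Q.rawMonoid using (IsMonoidHomomorphism)
  field
    ⟦_⟧                  : P.Carrier → Q.Carrier
    isMonoidHomomorphism : IsMonoidHomomorphism ⟦_⟧
    0-homo               : ⟦ P.0# ⟧ Q.≈ Q.0#
    Null-homo            : ∀ {x y z} → P.Null x y z → Q.Null ⟦ x ⟧ ⟦ y ⟧ ⟦ z ⟧

  open IsMonoidHomomorphism isMonoidHomomorphism public
    using (⟦⟧-cong) renaming (homo to *-homo; ε-homo to 1-homo)

  nonzero : ∀ {x} → x P.≉ P.0# → ⟦ x ⟧ Q.≉ Q.0#
  nonzero {x} x≉0 with y , xy≈1 ← P.invertible x≉0 =
    Q.unit⇒nonzero (Q.≈-trans (Q.≈-sym (*-homo x y)) (Q.≈-trans (⟦⟧-cong xy≈1) 1-homo))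

  ⟦_⟧ᵘ : P.Unit → Q.Unit
  ⟦ x , x≉0 ⟧ᵘ = ⟦ x ⟧ , nonzero x≉0

  -‿homo : ∀ x → ⟦ P.- x ⟧ Q.≈ Q.- ⟦ x ⟧
  -‿homo x = Q.≈-sym (Q.-‿unique (Q.Null-resp Q.≈-refl Q.≈-refl 0-homo (Null-homo (P.-‿null x))))

infixr 9 _∘ᴹ_
_∘ᴹ_ : {P : Pasture c ℓ ν} {Q : Pasture c′ ℓ′ ν′} {R : Pasture c″ ℓ″ ν″} →
       Morphism Q R → Morphism P Q → Morphism P R
_∘ᴹ_ {R = R} g f = record
  { ⟦_⟧ = g.⟦_⟧ ∘ f.⟦_⟧
  ; isMonoidHomomorphism = record
    { isMagmaHomomorphism = record
      { isRelHomomorphism = record { cong = g.⟦⟧-cong ∘ f.⟦⟧-cong }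
      ; homo = λ x y → R.≈-trans (g.⟦⟧-cong (f.*-homo x y)) (g.*-homo _ _) }
    ; ε-homo = R.≈-trans (g.⟦⟧-cong f.1-homo) g.1-homo }
  ; 0-homo = R.≈-trans (g.⟦⟧-cong f.0-homo) g.0-homo
  ; Null-homo = g.Null-homo ∘ f.Null-homo }
  where
  module f = Morphism f
  module g = Morphism g
  module R = Pasture R

Hom : Pasture c ℓ ν → Pasture c′ ℓ′ ν′ → Setoid (c ⊔ ℓ ⊔ ν ⊔ c′ ⊔ ℓ′ ⊔ ν′) (c ⊔ ℓ′)
Hom P Q = record
  { Carrier = Morphism P Q
  ; _≈_ = λ f g → ∀ x → Morphism.⟦ f ⟧ x Q.≈ Morphism.⟦ g ⟧ x
  ; isEquivalence = record
    { refl = λ x → Q.≈-refl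
    ; sym = λ f≈g x → Q.≈-sym (f≈g x)
    ; trans = λ f≈g g≈h x → Q.≈-trans (f≈g x) (g≈h x) } }
  where module Q = Pasture Q

Monomial : ℕ → Set
Monomial k = Sign × Vec ℤ k

infixl 7 _∙_
_∙_ : Monomial k → Monomial k → Monomial k
(s , d) ∙ (t , e) = s Sign.* t , zipWith ℤ._+_ d e

1ᵐ : Monomial k
1ᵐ = Sign.+ , replicate _ 0ℤ

infixl 7 _÷_
_÷_ : Monomial k → Monomial k → Monomial k
(s , d) ÷ (t , e) = s Sign.* t , zipWith ℤ._-_ d e

var : Fin k → Monomial k
var i = Sign.+ , replicate _ 0ℤ [ i ]≔ 1ℤ

-- ⌜ s , (e₁ ∷ … ∷ eₖ ∷ []) ⌝ is s x₁^e₁ ⋯ xₖ^eₖ.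
data Free (k : ℕ) : Set where
  0ᶠ : Free k
  ⌜_⌝ : Monomial k → Free k

infixl 7 _*ᶠ_
_*ᶠ_ : Free k → Free k → Free k
0ᶠ    *ᶠ y     = 0ᶠ
⌜ u ⌝ *ᶠ 0ᶠ    = 0ᶠ
⌜ u ⌝ *ᶠ ⌜ v ⌝ = ⌜ u ∙ v ⌝

1ᶠ : Free k
1ᶠ = ⌜ 1ᵐ ⌝

negᶠ : Free k → Free k
negᶠ 0ᶠ          = 0ᶠ
negᶠ ⌜ s , e ⌝ = ⌜ Sign.opposite s , e ⌝

data FreeNull {k : ℕ} : Free k → Free k → Free k → Set where
  null₁₂ : ∀ x → FreeNull x (negᶠ x) 0ᶠ
  null₁₃ : ∀ x → FreeNull x 0ᶠ (negᶠ x)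
  null₂₃ : ∀ x → FreeNull 0ᶠ x (negᶠ x)

private
  ∙-assoc : (u v w : Monomial k) → (u ∙ v) ∙ w ≡ u ∙ (v ∙ w)
  ∙-assoc (s , d) (t , e) (r , f) = cong₂ _,_ (Sign.*-assoc s t r) (Vec.zipWith-assoc ℤ.+-assoc d e f)

  ∙-comm : (u v : Monomial k) → u ∙ v ≡ v ∙ u
  ∙-comm (s , d) (t , e) = cong₂ _,_ (Sign.*-comm s t) (Vec.zipWith-comm ℤ.+-comm d e)

  ∙-identityˡ : (u : Monomial k) → 1ᵐ ∙ u ≡ u
  ∙-identityˡ (s , d) = cong₂ _,_ refl (Vec.zipWith-identityˡ ℤ.+-identityˡ d)

  *ᶠ-assoc : (x y z : Free k) → (x *ᶠ y) *ᶠ z ≡ x *ᶠ (y *ᶠ z)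
  *ᶠ-assoc 0ᶠ y z = refl
  *ᶠ-assoc ⌜ u ⌝ 0ᶠ z = refl
  *ᶠ-assoc ⌜ u ⌝ ⌜ v ⌝ 0ᶠ = refl
  *ᶠ-assoc ⌜ u ⌝ ⌜ v ⌝ ⌜ w ⌝ = cong ⌜_⌝ (∙-assoc u v w)

  *ᶠ-comm : (x y : Free k) → x *ᶠ y ≡ y *ᶠ x
  *ᶠ-comm 0ᶠ 0ᶠ = refl
  *ᶠ-comm 0ᶠ ⌜ v ⌝ = refl
  *ᶠ-comm ⌜ u ⌝ 0ᶠ = refl
  *ᶠ-comm ⌜ u ⌝ ⌜ v ⌝ = cong ⌜_⌝ (∙-comm u v)

  *ᶠ-identityˡ : (x : Free k) → 1ᶠ *ᶠ x ≡ x
  *ᶠ-identityˡ 0ᶠ = refl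
  *ᶠ-identityˡ ⌜ u ⌝ = cong ⌜_⌝ (∙-identityˡ u)

  *ᶠ-zeroʳ : (x : Free k) → x *ᶠ 0ᶠ ≡ 0ᶠ
  *ᶠ-zeroʳ 0ᶠ = refl
  *ᶠ-zeroʳ ⌜ u ⌝ = refl

  s*opp : ∀ s t → s Sign.* Sign.opposite t ≡ Sign.opposite (s Sign.* t)
  s*opp Sign.+ t = refl
  s*opp Sign.- Sign.+ = refl
  s*opp Sign.- Sign.- = refl

  negᶠ-* : (x y : Free k) → x *ᶠ negᶠ y ≡ negᶠ (x *ᶠ y)
  negᶠ-* 0ᶠ y = refl
  negᶠ-* ⌜ u ⌝ 0ᶠ = refl
  negᶠ-* ⌜ s , d ⌝ ⌜ t , e ⌝ = cong (λ r → ⌜ r , zipWith ℤ._+_ d e ⌝) (s*opp s t)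

  negᶠ-involutive : (x : Free k) → negᶠ (negᶠ x) ≡ x
  negᶠ-involutive 0ᶠ = refl
  negᶠ-involutive ⌜ s , e ⌝ = cong (λ r → ⌜ r , e ⌝) (Sign.opposite-selfInverse {s} refl)

  *ᶠ-isCommutativeMonoid : IsCommutativeMonoid _≡_ (_*ᶠ_ {k}) 1ᶠ
  *ᶠ-isCommutativeMonoid = record
    { isMonoid = record
      { isSemigroup = record
        { isMagma = record { isEquivalence = isEquivalence ; ∙-cong = cong₂ _*ᶠ_ }
        ; assoc = *ᶠ-assoc }
      ; identity = *ᶠ-identityˡ , λ x → ≡.trans (*ᶠ-comm x 1ᶠ) (*ᶠ-identityˡ x) }
    ; comm = *ᶠ-comm }

  inverseᶠ : {x : Free k} → x ≢ 0ᶠ → ∃[ y ] x *ᶠ y ≡ 1ᶠ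
  inverseᶠ {x = 0ᶠ} x≢0 = contradiction refl x≢0
  inverseᶠ {x = ⌜ s , d ⌝} x≢0 = ⌜ s , Vec.map ℤ.-_ d ⌝ ,
    cong ⌜_⌝ (cong₂ _,_ (Sign.s*s≡+ s) (Vec.zipWith-inverseʳ ℤ.+-inverseʳ d))

  FreeNull-swap₁₂ : {x y z : Free k} → FreeNull x y z → FreeNull y x z
  FreeNull-swap₁₂ (null₁₂ x) = ≡.subst (λ y → FreeNull (negᶠ x) y 0ᶠ) (negᶠ-involutive x) (null₁₂ (negᶠ x))
  FreeNull-swap₁₂ (null₁₃ x) = null₂₃ x
  FreeNull-swap₁₂ (null₂₃ x) = null₁₃ x

  FreeNull-swap₂₃ : {x y z : Free k} → FreeNull x y z → FreeNull x z y
  FreeNull-swap₂₃ (null₁₂ x) = null₁₃ x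
  FreeNull-swap₂₃ (null₁₃ x) = null₁₂ x
  FreeNull-swap₂₃ (null₂₃ x) = ≡.subst (λ y → FreeNull 0ᶠ (negᶠ x) y) (negᶠ-involutive x) (null₂₃ (negᶠ x))

  FreeNull-resp : {x x′ y y′ z z′ : Free k} → x ≡ x′ → y ≡ y′ → z ≡ z′ → FreeNull x y z → FreeNull x′ y′ z′
  FreeNull-resp refl refl refl N = N

  FreeNull-* : ∀ d {x y z : Free k} → FreeNull x y z → FreeNull (d *ᶠ x) (d *ᶠ y) (d *ᶠ z)
  FreeNull-* d (null₁₂ x) = FreeNull-resp refl (≡.sym (negᶠ-* d x)) (≡.sym (*ᶠ-zeroʳ d)) (null₁₂ (d *ᶠ x))
  FreeNull-* d (null₁₃ x) = FreeNull-resp refl (≡.sym (*ᶠ-zeroʳ d)) (≡.sym (negᶠ-* d x)) (null₁₃ (d *ᶠ x))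
  FreeNull-* d (null₂₃ x) = FreeNull-resp (≡.sym (*ᶠ-zeroʳ d)) refl (≡.sym (negᶠ-* d x)) (null₂₃ (d *ᶠ x))

  FreeNull-unique : {x y z : Free k} → FreeNull x y z → z ≡ 0ᶠ → negᶠ x ≡ y
  FreeNull-unique (null₁₂ x) _ = refl
  FreeNull-unique (null₁₃ 0ᶠ) _ = refl
  FreeNull-unique (null₁₃ ⌜ s , e ⌝) ()
  FreeNull-unique (null₂₃ 0ᶠ) _ = refl
  FreeNull-unique (null₂₃ ⌜ s , e ⌝) ()

F₁± : ℕ → Pasture 0ℓ 0ℓ 0ℓ
F₁± k = record
  { Carrier = Free k
  ; _≈_ = _≡_
  ; _*_ = _*ᶠ_
  ; 0# = 0ᶠ
  ; 1# = 1ᶠ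
  ; isCommutativeMonoid = *ᶠ-isCommutativeMonoid
  ; *-zero = (λ x → refl) , *ᶠ-zeroʳ
  ; 0≉1 = λ ()
  ; invertible = inverseᶠ
  ; Null = FreeNull
  ; Null-resp = FreeNull-resp
  ; Null-swap₁₂ = FreeNull-swap₁₂
  ; Null-swap₂₃ = FreeNull-swap₂₃
  ; Null-* = FreeNull-*
  ; negation = λ x → negᶠ x , null₁₂ x , λ N → FreeNull-unique N refl }

-- A predicate on triples stands for the set of their classes in Sym³.
Relations : ℕ → Set₁
Relations k = Free k → Free k → Free k → Set

-- T contains no class x + 0 + 0 with x nonzero.
Admissible : Relations k → Set
Admissible T = ∀ {x} → T x 0ᶠ 0ᶠ ⊎ T 0ᶠ x 0ᶠ ⊎ T 0ᶠ 0ᶠ x → x ≡ 0ᶠ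

-- The null set generated by T on F₁± k, before any identification.
data ⟨_⟩ {k} (T : Relations k) : Relations k where
  base    : ∀ {x y z} → FreeNull x y z → ⟨ T ⟩ x y z
  rel     : ∀ {x y z} → T x y z → ⟨ T ⟩ x y z
  swap₁₂  : ∀ {x y z} → ⟨ T ⟩ x y z → ⟨ T ⟩ y x z
  swap₂₃  : ∀ {x y z} → ⟨ T ⟩ x y z → ⟨ T ⟩ x z y
  scale   : ∀ d {x y z} → ⟨ T ⟩ x y z → ⟨ T ⟩ (d *ᶠ x) (d *ᶠ y) (d *ᶠ z)

-- The least identification making additive inverses unique: x and y are
-- identified when x - y lies in ⟨ T ⟩.  It is compatible with products
-- because ⟨ T ⟩ is closed under scaling.
infix 4 _⊢_≈_
_⊢_≈_ : Relations k → Rel (Free k) 0ℓ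
T ⊢ x ≈ y = EqClosure (λ u v → ⟨ T ⟩ u (negᶠ v) 0ᶠ) x y

QuotientNull : Relations k → Relations k
QuotientNull T x y z =
  ∃[ x′ ] ∃[ y′ ] ∃[ z′ ] (T ⊢ x ≈ x′) × (T ⊢ y ≈ y′) × (T ⊢ z ≈ z′) × ⟨ T ⟩ x′ y′ z′

module _ (T : Relations k) (adm : Admissible T) where

  private
    module E = IsEquivalence (EqC.isEquivalence (λ u v → ⟨ T ⟩ u (negᶠ v) 0ᶠ))

    *ᶠ-zero-product : (d x : Free k) → d *ᶠ x ≡ 0ᶠ → d ≡ 0ᶠ ⊎ x ≡ 0ᶠ
    *ᶠ-zero-product 0ᶠ x _ = inj₁ refl
    *ᶠ-zero-product ⌜ u ⌝ 0ᶠ _ = inj₂ refl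
    *ᶠ-zero-product ⌜ u ⌝ ⌜ v ⌝ ()

    scale-zero : (d : Free k) {x y z : Free k} →
                 (y ≡ 0ᶠ → z ≡ 0ᶠ → x ≡ 0ᶠ) → d *ᶠ y ≡ 0ᶠ → d *ᶠ z ≡ 0ᶠ → d *ᶠ x ≡ 0ᶠ
    scale-zero d {x} {y} {z} h p q with *ᶠ-zero-product d y p | *ᶠ-zero-product d z q
    ... | inj₁ refl | _         = refl
    ... | inj₂ y≡0  | inj₁ refl = refl
    ... | inj₂ y≡0  | inj₂ z≡0 rewrite h y≡0 z≡0 = *ᶠ-zeroʳ d

    negᶠ-zero : (x : Free k) → negᶠ x ≡ 0ᶠ → x ≡ 0ᶠ
    negᶠ-zero 0ᶠ _ = refl

    NotSingleton : Relations k
    NotSingleton x y z = (y ≡ 0ᶠ → z ≡ 0ᶠ → x ≡ 0ᶠ) × (x ≡ 0ᶠ → z ≡ 0ᶠ → y ≡ 0ᶠ) × (x ≡ 0ᶠ → y ≡ 0ᶠ → z ≡ 0ᶠ)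

    no-singleton : ∀ {x y z} → ⟨ T ⟩ x y z → NotSingleton x y z
    no-singleton (base (null₁₂ x)) = (λ p _ → negᶠ-zero x p) , (λ p _ → cong negᶠ p) , (λ _ _ → refl)
    no-singleton (base (null₁₃ x)) = (λ _ p → negᶠ-zero x p) , (λ _ _ → refl) , (λ p _ → cong negᶠ p)
    no-singleton (base (null₂₃ x)) = (λ _ _ → refl) , (λ _ p → negᶠ-zero x p) , (λ _ p → cong negᶠ p)
    no-singleton (rel t) =
      (λ { refl refl → adm (inj₁ t) }) , (λ { refl refl → adm (inj₂ (inj₁ t)) }) , (λ { refl refl → adm (inj₂ (inj₂ t)) })
    no-singleton (swap₁₂ N) with p , q , r ← no-singleton N = q , p , (λ y x → r x y)
    no-singleton (swap₂₃ N) with p , q , r ← no-singleton N = (λ z y → p y z) , r , q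
    no-singleton (scale d N) with p , q , r ← no-singleton N = scale-zero d p , scale-zero d q , scale-zero d r

    ≈-zero : ∀ {x y} → T ⊢ x ≈ y → x ≡ 0ᶠ → y ≡ 0ᶠ
    ≈-zero ε p = p
    ≈-zero (fwd N ◅ ps) p = ≈-zero ps (negᶠ-zero _ (proj₁ (proj₂ (no-singleton N)) p refl))
    ≈-zero (bwd N ◅ ps) p = ≈-zero ps (proj₁ (no-singleton N) (cong negᶠ p) refl)

    scale-≈ : ∀ d {x y} → T ⊢ x ≈ y → T ⊢ d *ᶠ x ≈ d *ᶠ y
    scale-≈ d = EqC.gmap (d *ᶠ_) λ {u} {v} N →
      ≡.subst₂ (⟨ T ⟩ (d *ᶠ u)) (negᶠ-* d v) (*ᶠ-zeroʳ d) (scale d N)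

    neg-≈ : ∀ {x y} → T ⊢ x ≈ y → T ⊢ negᶠ x ≈ negᶠ y
    neg-≈ {x} {y} p = ≡.subst₂ (T ⊢_≈_) (neg1 x) (neg1 y) (scale-≈ (negᶠ 1ᶠ) p)
      where
      neg1 : ∀ z → negᶠ 1ᶠ *ᶠ z ≡ negᶠ z
      neg1 z = ≡.trans (*ᶠ-comm (negᶠ 1ᶠ) z) (≡.trans (negᶠ-* z 1ᶠ)
                 (cong negᶠ (≡.trans (*ᶠ-comm z 1ᶠ) (*ᶠ-identityˡ z))))

    *-cong-≈ : ∀ {x x′ y y′} → T ⊢ x ≈ x′ → T ⊢ y ≈ y′ → T ⊢ x *ᶠ y ≈ x′ *ᶠ y′
    *-cong-≈ {x} {x′} {y} {y′} p q = E.trans (scale-≈ x q)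
      (≡.subst₂ (T ⊢_≈_) (*ᶠ-comm y′ x) (*ᶠ-comm y′ x′) (scale-≈ y′ p))

    QN-unique : ∀ {x y} → QuotientNull T x y 0ᶠ → T ⊢ negᶠ x ≈ y
    QN-unique {x} {y} (x′ , y′ , z′ , p , q , r , N) with refl ← ≈-zero r refl =
      E.trans (neg-≈ p) (E.sym (E.trans q (fwd N′ ◅ ε)))
      where
      N′ : ⟨ T ⟩ y′ (negᶠ (negᶠ x′)) 0ᶠ
      N′ rewrite negᶠ-involutive x′ = swap₁₂ N

  Quotient : Pasture 0ℓ 0ℓ 0ℓ
  Quotient = record
    { Carrier = Free k
    ; _≈_ = T ⊢_≈_
    ; _*_ = _*ᶠ_
    ; 0# = 0ᶠ
    ; 1# = 1ᶠ
    ; isCommutativeMonoid = record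
      { isMonoid = record
        { isSemigroup = record
          { isMagma = record { isEquivalence = EqC.isEquivalence _ ; ∙-cong = *-cong-≈ }
          ; assoc = λ x y z → E.reflexive (*ᶠ-assoc x y z) }
        ; identity = (λ x → E.reflexive (*ᶠ-identityˡ x))
                   , (λ x → E.reflexive (≡.trans (*ᶠ-comm x 1ᶠ) (*ᶠ-identityˡ x))) }
      ; comm = λ x y → E.reflexive (*ᶠ-comm x y) }
    ; *-zero = (λ x → E.refl) , (λ x → E.reflexive (*ᶠ-zeroʳ x))
    ; 0≉1 = λ 0≈1 → contradiction (≈-zero 0≈1 refl) λ ()
    ; invertible = λ x≉0 → let y , xy≡1 = inverseᶠ (x≉0 ∘ E.reflexive) in y , E.reflexive xy≡1
    ; Null = QuotientNull T
    ; Null-resp = λ p q r (_ , _ , _ , p′ , q′ , r′ , N) →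
        _ , _ , _ , E.trans (E.sym p) p′ , E.trans (E.sym q) q′ , E.trans (E.sym r) r′ , N
    ; Null-swap₁₂ = λ (_ , _ , _ , p , q , r , N) → _ , _ , _ , q , p , r , swap₁₂ N
    ; Null-swap₂₃ = λ (_ , _ , _ , p , q , r , N) → _ , _ , _ , p , r , q , swap₂₃ N
    ; Null-* = λ d (_ , _ , _ , p , q , r , N) →
        _ , _ , _ , scale-≈ d p , scale-≈ d q , scale-≈ d r , scale d N
    ; negation = λ x → negᶠ x , (_ , _ , _ , E.refl , E.refl , E.refl , base (null₁₂ x)) , QN-unique }

module _ {c ℓ} (G : AbelianGroup c ℓ) where
  private
    module G = AbelianGroup G
    module GP = AbelianGroupProperties G
    open Mult G.monoid using () renaming (_×_ to _×ᴳ_)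
    module M = Mult G.monoid
    open SetoidReasoning G.setoid
    open CommutativeSemigroupProperties (CommutativeMonoid.commutativeSemigroup G.commutativeMonoid)
      using (interchange)

  infixr 8 _^_
  _^_ : G.Carrier → ℤ → G.Carrier
  u ^ (+ m)      = m ×ᴳ u
  u ^ (-[1+ m ]) = suc m ×ᴳ (u G.⁻¹)

  power : (Fin k → G.Carrier) → Vec ℤ k → G.Carrier
  power g []       = G.ε
  power g (e ∷ es) = (g zero ^ e) G.∙ power (g ∘ suc) es

  ^-⊖ : ∀ u m n → u ^ (m ℤ.⊖ n) G.≈ (m ×ᴳ u) G.∙ (n ×ᴳ (u G.⁻¹))
  ^-⊖ u m zero = G.sym (G.identityʳ _)
  ^-⊖ u zero (suc n) = G.sym (G.identityˡ _)
  ^-⊖ u (suc m) (suc n) rewrite ℤ.[1+m]⊖[1+n]≡m⊖n m n = begin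
    u ^ (m ℤ.⊖ n)                                                ≈⟨ ^-⊖ u m n ⟩
    (m ×ᴳ u) G.∙ (n ×ᴳ (u G.⁻¹))                                 ≈⟨ G.identityˡ _ ⟨
    G.ε G.∙ ((m ×ᴳ u) G.∙ (n ×ᴳ (u G.⁻¹)))                       ≈⟨ G.∙-congʳ (G.inverseʳ u) ⟨
    (u G.∙ (u G.⁻¹)) G.∙ ((m ×ᴳ u) G.∙ (n ×ᴳ (u G.⁻¹)))          ≈⟨ interchange _ _ _ _ ⟩
    (suc m ×ᴳ u) G.∙ (suc n ×ᴳ (u G.⁻¹))                         ∎

  ^-homo : ∀ u d e → u ^ (d ℤ.+ e) G.≈ (u ^ d) G.∙ (u ^ e)
  ^-homo u (+ m) (+ n) = M.×-homo-+ u m n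
  ^-homo u (+ m) -[1+ n ] = ^-⊖ u m (suc n)
  ^-homo u -[1+ m ] (+ n) = G.trans (^-⊖ u n (suc m)) (G.comm _ _)
  ^-homo u -[1+ m ] -[1+ n ] = begin
    suc (suc (m + n)) ×ᴳ (u G.⁻¹)                  ≡⟨ cong (λ j → suc j ×ᴳ (u G.⁻¹)) (ℕ.+-suc m n) ⟨
    (suc m + suc n) ×ᴳ (u G.⁻¹)                    ≈⟨ M.×-homo-+ (u G.⁻¹) (suc m) (suc n) ⟩
    (suc m ×ᴳ (u G.⁻¹)) G.∙ (suc n ×ᴳ (u G.⁻¹))    ∎

  power-homo : ∀ (g : Fin k → G.Carrier) d e →
               power g (zipWith ℤ._+_ d e) G.≈ power g d G.∙ power g e
  power-homo g [] [] = G.sym (G.identityˡ _)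
  power-homo g (d ∷ ds) (e ∷ es) =
    G.trans (G.∙-cong (^-homo (g zero) d e) (power-homo (g ∘ suc) ds es)) (interchange _ _ _ _)

  power-0 : ∀ (g : Fin k → G.Carrier) → power g (replicate k 0ℤ) G.≈ G.ε
  power-0 {zero} g = G.refl
  power-0 {suc k} g = G.trans (G.identityˡ _) (power-0 (g ∘ suc))

  power-cong : ∀ {g h : Fin k → G.Carrier} → (∀ i → g i G.≈ h i) → ∀ e → power g e G.≈ power h e
  power-cong g≈h [] = G.refl
  power-cong {g = g} {h} g≈h (e ∷ es) = G.∙-cong (^-cong e) (power-cong (g≈h ∘ suc) es)
    where
    ^-cong : ∀ e → g zero ^ e G.≈ h zero ^ e
    ^-cong (+ m) = M.×-congʳ m (g≈h zero)
    ^-cong -[1+ m ] = M.×-congʳ (suc m) (G.⁻¹-cong (g≈h zero))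

  power-basis : ∀ (g : Fin k → G.Carrier) i → power g (replicate k 0ℤ [ i ]≔ 1ℤ) G.≈ g i
  power-basis g zero = G.trans (G.∙-cong (G.identityʳ _) (power-0 (g ∘ suc))) (G.identityʳ _)
  power-basis g (suc i) = G.trans (G.identityˡ _) (power-basis (g ∘ suc) i)

  module _ (h : Vec ℤ k → G.Carrier)
           (h-homo : ∀ d e → h (zipWith ℤ._+_ d e) G.≈ h d G.∙ h e) where
    h-0 : h (replicate k 0ℤ) G.≈ G.ε
    h-0 = GP.identityʳ-unique _ _ (G.trans (G.sym (h-homo _ _))
      (G.reflexive (cong h (Vec.zipWith-identityˡ ℤ.+-identityˡ _))))

    h-neg : ∀ d → h (Vec.map ℤ.-_ d) G.≈ h d G.⁻¹
    h-neg d = GP.inverseʳ-unique _ _ (G.trans (G.sym (h-homo _ _))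
      (G.trans (G.reflexive (cong h (Vec.zipWith-inverseʳ ℤ.+-inverseʳ d))) h-0))

  homo⇒power : (h : Vec ℤ k → G.Carrier) →
               (∀ d e → h (zipWith ℤ._+_ d e) G.≈ h d G.∙ h e) →
               ∀ e → h e G.≈ power (λ i → h (replicate k 0ℤ [ i ]≔ 1ℤ)) e
  homo⇒power {zero} h h-homo [] = h-0 h h-homo
  homo⇒power {suc k} h h-homo (e ∷ es) = begin
    h (e ∷ es)                        ≡⟨ cong h (cong₂ _∷_ (ℤ.+-identityʳ e) (Vec.zipWith-identityˡ ℤ.+-identityˡ es)) ⟨
    h (zipWith ℤ._+_ (e ∷ replicate k 0ℤ) (0ℤ ∷ es))
                                      ≈⟨ h-homo _ _ ⟩
    h (e ∷ replicate k 0ℤ) G.∙ h (0ℤ ∷ es)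
      ≈⟨ G.∙-cong (head e) (homo⇒power (λ d → h (0ℤ ∷ d)) (λ d e → h-homo (0ℤ ∷ d) (0ℤ ∷ e)) es) ⟩
    power (λ i → h (replicate (suc k) 0ℤ [ i ]≔ 1ℤ)) (e ∷ es) ∎
    where
    z : Vec ℤ k
    z = replicate k 0ℤ
    pos : ∀ m → h (+ m ∷ z) G.≈ m ×ᴳ h (1ℤ ∷ z)
    pos zero = h-0 h h-homo
    pos (suc m) = G.trans (G.reflexive (cong (λ d → h (+ suc m ∷ d)) (≡.sym (Vec.zipWith-identityˡ ℤ.+-identityˡ z))))
      (G.trans (h-homo (1ℤ ∷ z) (+ m ∷ z)) (G.∙-congˡ (pos m)))
    head : ∀ e → h (e ∷ z) G.≈ h (1ℤ ∷ z) ^ e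
    head (+ m) = pos m
    head -[1+ m ] = begin
      h (-[1+ m ] ∷ z)                  ≡⟨ cong (λ d → h (-[1+ m ] ∷ d)) (Vec.map-replicate ℤ.-_ 0ℤ k) ⟨
      h (Vec.map ℤ.-_ (+ suc m ∷ z))    ≈⟨ h-neg h h-homo _ ⟩
      h (+ suc m ∷ z) G.⁻¹              ≈⟨ G.⁻¹-cong (pos (suc m)) ⟩
      (suc m ×ᴳ h (1ℤ ∷ z)) G.⁻¹        ≈⟨ ×-⁻¹ (suc m) ⟨
      suc m ×ᴳ (h (1ℤ ∷ z) G.⁻¹)        ∎
      where
      ×-⁻¹ : ∀ m {u} → m ×ᴳ (u G.⁻¹) G.≈ (m ×ᴳ u) G.⁻¹
      ×-⁻¹ zero = G.sym GP.ε⁻¹≈ε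
      ×-⁻¹ (suc m) = G.trans (G.∙-congˡ (×-⁻¹ m)) (GP.⁻¹-∙-comm _ _)

module _ (Q : Pasture c ℓ ν) where
  private
    module Q = Pasture Q
    module U = AbelianGroup Q.unitGroup

    Null-0 : Q.Null Q.0# Q.0# Q.0#
    Null-0 = Q.Null-resp (Q.zeroˡ _) (Q.zeroˡ _) (Q.zeroˡ _) (Q.Null-* Q.0# (Q.-‿null Q.1#))

    neg-unit : Q.Unit → Q.Unit
    neg-unit (x , x≉0) = Q.- x , λ -x≈0 → x≉0 (Q.≈-trans (Q.≈-sym (Q.-‿involutive x))
      (Q.-‿unique (Q.Null-resp (Q.≈-sym -x≈0) Q.≈-refl Q.≈-refl Null-0)))

  signed : Sign → Q.Unit → Q.Unit
  signed Sign.+ u = u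
  signed Sign.- u = neg-unit u

  private
    *-‿distribˡ : ∀ x y → Q.- x Q.* y Q.≈ Q.- (x Q.* y)
    *-‿distribˡ x y = Q.≈-trans (Q.comm _ _) (Q.≈-trans (Q.≈-sym (Q.*-‿distribʳ y x)) (Q.-‿cong (Q.comm y x)))

    signed-homo : ∀ s t u v → signed (s Sign.* t) (u U.∙ v) U.≈ signed s u U.∙ signed t v
    signed-homo Sign.+ Sign.+ u v = Q.≈-refl
    signed-homo Sign.+ Sign.- u v = Q.*-‿distribʳ _ _
    signed-homo Sign.- Sign.+ u v = Q.≈-sym (*-‿distribˡ _ _)
    signed-homo Sign.- Sign.- u v = Q.≈-sym (Q.≈-trans (*-‿distribˡ _ _)
      (Q.≈-trans (Q.-‿cong (Q.≈-sym (Q.*-‿distribʳ _ _))) (Q.-‿involutive _)))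

    signed-cong : ∀ s {u v} → u U.≈ v → signed s u U.≈ signed s v
    signed-cong Sign.+ u≈v = u≈v
    signed-cong Sign.- u≈v = Q.-‿cong u≈v

    signed-opposite : ∀ s u → proj₁ (signed (Sign.opposite s) u) Q.≈ Q.- proj₁ (signed s u)
    signed-opposite Sign.+ u = Q.≈-refl
    signed-opposite Sign.- u = Q.≈-sym (Q.-‿involutive _)

  -- Φ g is the morphism F₁±(x₁,…,xₖ) → Q with xᵢ ↦ g i.
  module _ (g : Fin k → Q.Unit) where
    private
      ⟦_⟧ : Free k → Q.Carrier
      ⟦ 0ᶠ ⟧        = Q.0#
      ⟦ ⌜ s , e ⌝ ⟧ = proj₁ (signed s (power Q.unitGroup g e))

      homo : ∀ x y → ⟦ x *ᶠ y ⟧ Q.≈ ⟦ x ⟧ Q.* ⟦ y ⟧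
      homo 0ᶠ y = Q.≈-sym (Q.zeroˡ _)
      homo ⌜ u ⌝ 0ᶠ = Q.≈-sym (Q.zeroʳ _)
      homo ⌜ s , d ⌝ ⌜ t , e ⌝ =
        Q.≈-trans (signed-cong (s Sign.* t) (power-homo Q.unitGroup g d e)) (signed-homo s t _ _)

      Null-neg : ∀ x → Q.Null ⟦ x ⟧ ⟦ negᶠ x ⟧ Q.0#
      Null-neg 0ᶠ = Null-0
      Null-neg ⌜ s , e ⌝ = Q.Null-resp Q.≈-refl (Q.≈-sym (signed-opposite s _)) Q.≈-refl (Q.-‿null _)

      Null-homo : ∀ {x y z} → FreeNull x y z → Q.Null ⟦ x ⟧ ⟦ y ⟧ ⟦ z ⟧
      Null-homo (null₁₂ x) = Null-neg x
      Null-homo (null₁₃ x) = Q.Null-swap₂₃ (Null-neg x)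
      Null-homo (null₂₃ x) = Q.Null-swap₁₂ (Q.Null-swap₂₃ (Null-neg x))

    Φ : Morphism (F₁± k) Q
    Φ = record
      { ⟦_⟧ = ⟦_⟧
      ; isMonoidHomomorphism = record
        { isMagmaHomomorphism = record
          { isRelHomomorphism = record { cong = λ { refl → Q.≈-refl } }
          ; homo = homo }
        ; ε-homo = power-0 Q.unitGroup g }
      ; 0-homo = Q.≈-refl
      ; Null-homo = Null-homo }

  module _ (T : Relations k) where
    Respects : (Fin k → Q.Unit) → Set ν
    Respects g = ∀ {x y z} → T x y z →
      Q.Null (Morphism.⟦ Φ g ⟧ x) (Morphism.⟦ Φ g ⟧ y) (Morphism.⟦ Φ g ⟧ z)

    Solutions : Setoid (c ⊔ ℓ ⊔ ν) ℓ
    Solutions = record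
      { Carrier = Σ (Fin k → Q.Unit) Respects
      ; _≈_ = λ (g , _) (h , _) → ∀ i → g i U.≈ h i
      ; isEquivalence = record
        { refl = λ i → Q.≈-refl
        ; sym = λ p i → Q.≈-sym (p i)
        ; trans = λ p q i → Q.≈-trans (p i) (q i) } }

    module _ (adm : Admissible T) where
      private
        mono-nonzero : (u : Monomial k) → Pasture._≉_ (Quotient T adm) ⌜ u ⌝ 0ᶠ
        mono-nonzero u = Pasture.unit⇒nonzero (Quotient T adm) {y = proj₁ inv} (Pasture.≈-reflexive (Quotient T adm) (proj₂ inv))
          where inv = Pasture.invertible (F₁± k) {⌜ u ⌝} λ ()

        values : Morphism (Quotient T adm) Q → Fin k → Q.Unit
        values f i = Morphism.⟦_⟧ᵘ f (⌜ var i ⌝ , mono-nonzero (var i))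

        determined : (f : Morphism (Quotient T adm) Q) → ∀ x →
                     Morphism.⟦ f ⟧ x Q.≈ Morphism.⟦ Φ (values f) ⟧ x
        determined f 0ᶠ = Morphism.0-homo f
        determined f ⌜ Sign.+ , e ⌝ = homo⇒power Q.unitGroup
          (λ e → Morphism.⟦_⟧ᵘ f (⌜ Sign.+ , e ⌝ , mono-nonzero (Sign.+ , e)))
          (λ d e → Morphism.*-homo f ⌜ Sign.+ , d ⌝ ⌜ Sign.+ , e ⌝) e
        determined f ⌜ Sign.- , e ⌝ =
          Q.≈-trans (Morphism.-‿homo f ⌜ Sign.+ , e ⌝) (Q.-‿cong (determined f ⌜ Sign.+ , e ⌝))

      restrict : Morphism (Quotient T adm) Q → Setoid.Carrier Solutions
      restrict f = values f , λ t → Q.Null-resp (determined f _) (determined f _) (determined f _)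
        (Morphism.Null-homo f (_ , _ , _ , ε , ε , ε , rel t))

      extend : Setoid.Carrier Solutions → Morphism (Quotient T adm) Q
      extend (g , g-resp) = record
        { ⟦_⟧ = ⟦_⟧
        ; isMonoidHomomorphism = record
          { isMagmaHomomorphism = record
            { isRelHomomorphism = record { cong = ⟨T⟩-cong }
            ; homo = *-homo }
          ; ε-homo = 1-homo }
        ; 0-homo = 0-homo
        ; Null-homo = λ (_ , _ , _ , p , q , r , N) → Q.Null-resp
            (Q.≈-sym (⟨T⟩-cong p)) (Q.≈-sym (⟨T⟩-cong q)) (Q.≈-sym (⟨T⟩-cong r)) (⟨T⟩-null N) }
        where
        open Morphism (Φ g)
        ⟨T⟩-null : ∀ {x y z} → ⟨ T ⟩ x y z → Q.Null ⟦ x ⟧ ⟦ y ⟧ ⟦ z ⟧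
        ⟨T⟩-null (base N) = Null-homo N
        ⟨T⟩-null (rel t) = g-resp t
        ⟨T⟩-null (swap₁₂ N) = Q.Null-swap₁₂ (⟨T⟩-null N)
        ⟨T⟩-null (swap₂₃ N) = Q.Null-swap₂₃ (⟨T⟩-null N)
        ⟨T⟩-null (scale d N) = Q.Null-resp (Q.≈-sym (*-homo d _)) (Q.≈-sym (*-homo d _)) (Q.≈-sym (*-homo d _))
          (Q.Null-* ⟦ d ⟧ (⟨T⟩-null N))
        ⟨T⟩-cong : ∀ {x y} → T ⊢ x ≈ y → ⟦ x ⟧ Q.≈ ⟦ y ⟧
        ⟨T⟩-cong = EqC.gfold (Setoid.isEquivalence Q.setoid) ⟦_⟧ λ {x} {y} N →
          Q.≈-trans (Q.≈-sym (Q.-‿involutive ⟦ x ⟧)) (Q.≈-trans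
            (Q.-‿cong (Q.≈-trans (Q.-‿unique (Q.Null-resp Q.≈-refl Q.≈-refl 0-homo (⟨T⟩-null N))) (-‿homo y)))
            (Q.-‿involutive ⟦ y ⟧))

      -- This characterizes Quotient T adm.
      universalProperty : Bijection (Hom (Quotient T adm) Q) Solutions
      universalProperty = record
        { to = restrict
        ; cong = λ f≈f′ i → f≈f′ ⌜ var i ⌝
        ; bijective =
            (λ {f} {f′} p x → Q.≈-trans (determined f x)
              (Q.≈-trans (Φ-cong p x) (Q.≈-sym (determined f′ x))))
          , λ (g , g-resp) → extend (g , g-resp) , λ f≈ i →
              Q.≈-trans (f≈ ⌜ var i ⌝) (power-basis Q.unitGroup g i) }
        where
        Φ-cong : ∀ {g h : Fin k → Q.Unit} → (∀ i → g i U.≈ h i) → ∀ x →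
                 Morphism.⟦ Φ g ⟧ x Q.≈ Morphism.⟦ Φ h ⟧ x
        Φ-cong p 0ᶠ = Q.≈-refl
        Φ-cong p ⌜ s , e ⌝ = signed-cong s (power-cong Q.unitGroup p e)

universalProperty-natural :
  {Q : Pasture c ℓ ν} {R : Pasture c′ ℓ′ ν′} (T : Relations k) (adm : Admissible T)
  (h : Morphism Q R) (f : Morphism (Quotient T adm) Q) (i : Fin k) →
  Pasture._≈_ R (proj₁ (proj₁ (restrict R T adm (h ∘ᴹ f)) i))
                (Morphism.⟦ h ⟧ (proj₁ (proj₁ (restrict Q T adm f) i)))
universalProperty-natural {R = R} T adm h f i = Pasture.≈-refl R

record Matroid (n : ℕ) : Set where
  field
    rank            : Subset n → ℕ
    rank-≤          : ∀ A → rank A ≤ ∣ A ∣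
    rank-mono       : ∀ {A B} → A ⊆ B → rank A ≤ rank B
    rank-submodular : ∀ A B → rank (A ∪ B) + rank (A ∩ B) ≤ rank A + rank B

module _ (M : Matroid n) where
  open Matroid M

  IsFlat : Subset n → Set
  IsFlat A = ∀ e → e ∉ A → rank A < rank (A ∪ ⁅ e ⁆)

  IsFlatOfCorank : ℕ → Subset n → Set
  IsFlatOfCorank k A = IsFlat A × rank A + k ≡ rank ⊤

  isFlatOfCorank? : ∀ k A → Dec (IsFlatOfCorank k A)
  isFlatOfCorank? k A =
    Fin.all? (λ e → ¬? (e Subset.∈? A) →-dec (rank A ℕ.<? rank (A ∪ ⁅ e ⁆))) ×-dec (rank A + k ℕ.≟ rank ⊤)

-- The proof is irrelevant, so that hyperplanes with equal underlying sets
-- are equal.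
record Hyperplane (M : Matroid n) : Set where
  constructor _,_
  field
    set           : Subset n
    .isHyperplane : IsFlatOfCorank M 1 set

open Hyperplane public using (set)

_≟ᴴ_ : {M : Matroid n} → DecidableEquality (Hyperplane M)
(A , p) ≟ᴴ (B , q) = map′ (λ { refl → refl }) (cong set) (Vec.≡-dec Bool._≟_ A B)

subsets : ∀ n → List (Subset n)
subsets zero    = [] ∷ []
subsets (suc n) = map (inside ∷_) (subsets n) ++ map (outside ∷_) (subsets n)

hyperplanes : (M : Matroid n) → List (Hyperplane M)
hyperplanes M = mapMaybe (λ A → Maybe.map (λ p → A , p) (dec⇒maybe (isFlatOfCorank? M 1 A))) (subsets _)

IsModular : (M : Matroid n) → List (Hyperplane M) → Set
IsModular M Hs = IsFlatOfCorank M 2 (⋂ (map set Hs))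

module _ (M : Matroid n) (P : Pasture c ℓ ν) where
  open Pasture P

  record Representation : Set (c ⊔ ℓ ⊔ ν) where
    field
      φ          : Hyperplane M → Fin n → Carrier
      φ-zero     : ∀ H e → φ H e ≈ 0# ⇔ e ∈ set H
      φ-modular  : ∀ H₁ H₂ H₃ → Unique (H₁ ∷ H₂ ∷ H₃ ∷ []) → IsModular M (H₁ ∷ H₂ ∷ H₃ ∷ []) →
                   ∃[ a ] ∃[ b ] ∃[ c ] ¬ (a ≈ 0# × b ≈ 0# × c ≈ 0#) ×
                   (∀ e → Null (a * φ H₁ e) (b * φ H₂ e) (c * φ H₃ e))

  open Representation

  RescalingEquivalent : Rel Representation (c ⊔ ℓ)
  RescalingEquivalent R R′ =
    Σ[ a ∈ (Hyperplane M → Unit) ] Σ[ t ∈ (Fin n → Unit) ]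
    (∀ H e → φ R′ H e ≈ proj₁ (a H) * proj₁ (t e) * φ R H e)

  -- The set R_M(P) of rescaling classes, as a setoid.
  RepresentationClasses : Setoid (c ⊔ ℓ ⊔ ν) (c ⊔ ℓ)
  RepresentationClasses = record
    { Carrier = Representation
    ; _≈_ = RescalingEquivalent
    ; isEquivalence = record
      { refl = (λ _ → U.ε) , (λ _ → U.ε) , λ H e →
          ≈-sym (≈-trans (∙-congʳ (identityˡ 1#)) (identityˡ _))
      ; sym = λ {R} {R′} (a , t , p) → (λ H → a H ⁻¹) , (λ e → t e ⁻¹) , λ H e → begin
          φ R H e
            ≈⟨ identityˡ _ ⟨
          1# * φ R H e
            ≈⟨ ∙-congʳ (U.inverseˡ (a H U.∙ t e)) ⟨
          proj₁ ((a H U.∙ t e) ⁻¹) * (proj₁ (a H) * proj₁ (t e)) * φ R H e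
            ≈⟨ assoc _ _ _ ⟩
          proj₁ ((a H U.∙ t e) ⁻¹) * (proj₁ (a H) * proj₁ (t e) * φ R H e)
            ≈⟨ ∙-cong (≈-sym (UP.⁻¹-∙-comm (a H) (t e))) (≈-sym (p H e)) ⟩
          proj₁ (a H ⁻¹) * proj₁ (t e ⁻¹) * φ R′ H e ∎
      ; trans = λ {R} {R′} {R″} (a , t , p) (a′ , t′ , p′) →
          (λ H → a′ H U.∙ a H) , (λ e → t′ e U.∙ t e) , λ H e → begin
          φ R″ H e
            ≈⟨ p′ H e ⟩
          proj₁ (a′ H) * proj₁ (t′ e) * φ R′ H e
            ≈⟨ ∙-congˡ (p H e) ⟩
          proj₁ (a′ H) * proj₁ (t′ e) * (proj₁ (a H) * proj₁ (t e) * φ R H e)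
            ≈⟨ assoc _ _ _ ⟨
          proj₁ (a′ H) * proj₁ (t′ e) * (proj₁ (a H) * proj₁ (t e)) * φ R H e
            ≈⟨ ∙-congʳ (interchange _ _ _ _) ⟩
          proj₁ (a′ H) * proj₁ (a H) * (proj₁ (t′ e) * proj₁ (t e)) * φ R H e ∎ } }
    where
    module U = AbelianGroup unitGroup
    module UP = AbelianGroupProperties unitGroup
    open SetoidReasoning setoid
    open CommutativeSemigroupProperties (CommutativeMonoid.commutativeSemigroup commutativeMonoid)
      using (interchange)

push : {M : Matroid n} {P : Pasture c ℓ ν} {Q : Pasture c′ ℓ′ ν′} →
       Morphism P Q → Representation M P → Representation M Q
push {M = M} {P} {Q} g R = record
  { φ = λ H e → ⟦ R.φ H e ⟧
  ; φ-zero = λ H e → let open Equivalence (R.φ-zero H e) in mk⇔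
      (λ gφ≈0 → decidable-stable (e Subset.∈? set H) λ e∉H → nonzero (e∉H ∘ to) gφ≈0)
      (λ e∈H → Q.≈-trans (⟦⟧-cong (from e∈H)) 0-homo)
  ; φ-modular = λ H₁ H₂ H₃ u m → let a , b , c , abc≉0 , N = R.φ-modular H₁ H₂ H₃ u m in
      ⟦ a ⟧ , ⟦ b ⟧ , ⟦ c ⟧
      , (λ (ga≈0 , gb≈0 , gc≈0) →
          nonzero (λ a≈0 → nonzero (λ b≈0 → nonzero (λ c≈0 → abc≉0 (a≈0 , b≈0 , c≈0)) gc≈0) gb≈0) ga≈0)
      , λ e → Q.Null-resp (*-homo _ _) (*-homo _ _) (*-homo _ _) (Null-homo (N e)) }
  where
  open Morphism g
  module Q = Pasture Q
  module R = Representation R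

module _ (M : Matroid n) where

  Vertex : Set
  Vertex = Hyperplane M ⊎ Fin n

  -- Edges of the bipartite graphs considered join H to e.
  EdgeSet : Set₁
  EdgeSet = Pred (Hyperplane M × Fin n) 0ℓ

  incidenceGraph : EdgeSet
  incidenceGraph (H , e) = e ∉ set H

module _ {M : Matroid n} where

  data Adjacent (F : EdgeSet M) : Rel (Vertex M) 0ℓ where
    forwards  : ∀ {H e} → (H , e) ∈ᴾ F → Adjacent F (inj₁ H) (inj₂ e)
    backwards : ∀ {H e} → (H , e) ∈ᴾ F → Adjacent F (inj₂ e) (inj₁ H)

  record Cycle (F : EdgeSet M) : Set where
    field
      start    : Vertex M
      rest     : List (Vertex M)
      distinct : Unique (start ∷ rest)
      long     : length (start ∷ rest) ≥ 3
      closed   : Linked (Adjacent F) (start ∷ rest ++ start ∷ [])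

  Acyclic : EdgeSet M → Set
  Acyclic F = ¬ Cycle F

record IsSpanningForest (M : Matroid n) (F : EdgeSet M) : Set₁ where
  field
    edges   : F ⊆ᴾ incidenceGraph M
    acyclic : Acyclic F
    maximal : ∀ {F′ : EdgeSet M} → F′ ⊆ᴾ incidenceGraph M → Acyclic F′ → F ⊆ᴾ F′ → F′ ⊆ᴾ F

module _ (M : Matroid n) {F : EdgeSet M} (F? : Decidable F) where

  -- An enumeration x₁, …, xₖ of S = E(G_M) ∖ F.
  S : List (Hyperplane M × Fin n)
  S = filter (λ (H , e) → ¬? (e Subset.∈? set H) ×-dec ¬? (F? (H , e)))
             (cartesianProduct (hyperplanes M) (allFin n))

  _≟ᴱ_ : DecidableEquality (Hyperplane M × Fin n)
  _≟ᴱ_ = ≡-dec _≟ᴴ_ Fin._≟_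

  open DecMembership _≟ᴱ_ using (_∈?_)

  -- Pairs outside S get the value 1; these are the edges in F and the
  -- pairs with e ∈ H, and the latter never occur in T below: two distinct
  -- members of a modular tuple meet in the corank 2 flat L.
  x : Hyperplane M → Fin n → Monomial (length S)
  x H e with (H , e) ∈? S
  ... | yes i = var (index i)
  ... | no  _ = 1ᵐ

  data T : Relations (length S) where
    T₁ : ∀ H₁ H₂ H₃ → Unique (H₁ ∷ H₂ ∷ H₃ ∷ []) → IsModular M (H₁ ∷ H₂ ∷ H₃ ∷ []) →
         let L = ⋂ (map set (H₁ ∷ H₂ ∷ H₃ ∷ [])) in
         ∀ {a₁ a₂ a₃} → a₁ ∈ set H₁ ─ L → a₂ ∈ set H₂ ─ L → a₃ ∈ set H₃ ─ L →
         T ⌜ (x H₁ a₂ ∙ x H₂ a₃ ∙ x H₃ a₁) ÷ (x H₁ a₃ ∙ x H₂ a₁ ∙ x H₃ a₂) ⌝ 1ᶠ 0ᶠ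
    T₂ : ∀ H₁ H₂ H₃ H₄ → Unique (H₁ ∷ H₂ ∷ H₃ ∷ H₄ ∷ []) → IsModular M (H₁ ∷ H₂ ∷ H₃ ∷ H₄ ∷ []) →
         let L = ⋂ (map set (H₁ ∷ H₂ ∷ H₃ ∷ H₄ ∷ [])) in
         ∀ {a₁ a₂ a₃ a₄} → a₁ ∈ set H₁ ─ L → a₂ ∈ set H₂ ─ L → a₃ ∈ set H₃ ─ L → a₄ ∈ set H₄ ─ L →
         T ⌜ (x H₁ a₃ ∙ x H₂ a₄) ÷ (x H₁ a₄ ∙ x H₂ a₃) ⌝
           ⌜ (x H₁ a₂ ∙ x H₃ a₄) ÷ (x H₁ a₄ ∙ x H₃ a₂) ⌝
           (negᶠ 1ᶠ)

  T-admissible : Admissible T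
  T-admissible (inj₁ ())
  T-admissible (inj₂ (inj₁ ()))
  T-admissible (inj₂ (inj₂ ()))

{-# OPTIONS --safe #-}
module Submission where

-- The rescaling class of a representation contains exactly one member φ with
-- φ_H(e) = 1 for all (H , e) in the spanning forest F: since F is acyclic the
-- conditions a_H t_e φ_H(e) = 1 can be solved one edge at a time, and since F
-- is maximal it connects the two ends of every edge of G_M, so that a
-- rescaling between two such members is trivial on G_M.  The remaining values,
-- at the edges in S, are the images of the indeterminates.
--
-- It remains to see that a family of hyperplane functions is a representation
-- iff it satisfies (T1) and (T2).  Evaluating a linear dependency between H₁,
-- H₂, H₃ at aᵢ ∈ Hᵢ ∖ L determines the ratios of its coefficients and gives
-- (T1); evaluating it at a₄ gives (T2).  Conversely (T1) and (T2) imply that the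
-- coefficients found from one choice of the aᵢ work at every e: this is (T1) for
-- e in some Hᵢ, and (T2) with H₄ the hyperplane spanned by L and e otherwise.

open import Defs
open import Algebra.Bundles using (AbelianGroup)
import Algebra.Properties.AbelianGroup as AbelianGroupProperties
import Algebra.Solver.CommutativeMonoid as CommutativeMonoidSolver
import Data.Bool as Bool
open import Data.Empty using (⊥; ⊥-elim)
open import Data.Fin using (Fin; zero; suc)
import Data.Fin.Properties as Fin
open import Data.Fin.Subset using (Subset; inside; outside; _∈_; _∉_; _⊆_; _⊈_; _∪_; _∩_; _─_; ⋂; ⊤; ⁅_⁆; ∣_∣)
import Data.Fin.Subset.Properties as Subset
open import Data.Integer using (ℤ)
import Data.Integer as ℤ
import Data.Integer.Properties as ℤ
open import Data.List using (List; []; _∷_; _++_; map; mapMaybe; filter; cartesianProduct; allFin; lookup; length)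
import Data.List.Properties as List
import Data.List.Membership.DecPropositional as DecMembership
open import Data.List.Membership.Propositional using () renaming (_∈_ to _∈ˡ_; _∉_ to _∉ˡ_)
open import Data.List.Membership.Propositional.Properties using (∈-∃++; ∈-map⁺; ∈-map⁻; ∈-++⁺ˡ; ∈-++⁺ʳ)
open import Data.List.Membership.Propositional.Properties using (∈-filter⁺; ∈-filter⁻; ∈-cartesianProduct⁺; ∈-allFin; ∈-lookup)
open import Data.List.Relation.Binary.Permutation.Propositional using (↭⇒↭ₛ)
open import Data.List.Relation.Binary.Permutation.Propositional.Properties using (↭-length; ++-comm)
import Data.List.Relation.Binary.Permutation.Setoid.Properties as Permutationₛ
open import Data.List.Relation.Unary.All using (All; []; _∷_)
import Data.List.Relation.Unary.All as All
import Data.List.Relation.Unary.All.Properties as All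
open import Data.List.Relation.Unary.AllPairs using ([]; _∷_)
import Data.List.Relation.Unary.AllPairs as AllPairs
open import Data.List.Relation.Unary.Any using (here; there; index)
import Data.List.Relation.Unary.Any as Any
import Data.List.Relation.Unary.Any.Properties as Any
open import Data.List.Relation.Unary.Linked using (Linked; []; [-]; _∷_)
import Data.List.Relation.Unary.Linked as Linked
open import Data.List.Relation.Unary.Unique.Propositional using (Unique)
import Data.List.Relation.Unary.Unique.Propositional.Properties as Unique
open import Data.Maybe using (Maybe; just; nothing)
import Data.Maybe as Maybe
import Data.Maybe.Relation.Unary.All as MaybeAll
import Data.Maybe.Relation.Unary.Any as MaybeAny
open import Data.Nat using (ℕ; zero; suc; _+_; _≤_; s≤s; z≤n)
import Data.Nat.Properties as ℕ
open import Data.Product using (Σ-syntax; ∃-syntax; _×_; _,_; proj₁; proj₂)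
open import Data.Product.Properties using (≡-dec)
import Data.Sign as Sign
import Data.Sign.Properties as Sign
open import Data.Sum using (_⊎_; inj₁; inj₂; [_,_]′)
import Data.Sum.Properties as Sum
open import Data.Vec using (Vec; []; _∷_; here; there; tabulate; zipWith)
import Data.Vec.Properties as Vec
open import Function using (_∘_; id)
open import Function.Bundles using (_⇔_; mk⇔; module Equivalence; Bijection; Inverse)
import Function.Construct.Composition as Composition
open import Function.Properties.Bijection using (Bijection⇒Inverse)
open import Function.Properties.Inverse using (Inverse⇒Bijection) renaming (sym to inverse-sym)
open import Level using (Level; 0ℓ)
open import Relation.Binary using (Rel; Setoid; DecidableEquality; _⇒_)
open import Relation.Binary.Construct.Closure.ReflexiveTransitive using (Star; ε; _◅_; _◅◅_)
import Relation.Binary.Construct.Closure.ReflexiveTransitive as Star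
open import Relation.Binary.PropositionalEquality as ≡ using (_≡_; _≢_; refl; cong; cong₂; subst)
import Relation.Binary.Reasoning.Setoid as SetoidReasoning
open import Relation.Nullary using (¬_; yes; no; contradiction; does; recompute)
open import Relation.Nullary.Decidable using (dec⇒maybe; dec-true; decidable-stable)
open import Relation.Unary using (Decidable) renaming (_⊆_ to _⊆ᴾ_; _∈_ to _∈ᴾ_)

private
  variable
    k n : ℕ
    c ℓ ν c′ ℓ′ ν′ : Level

-- Flats of a matroid

x∈p─q⇒x∉q : ∀ (p q : Subset n) {x} → x ∈ p ─ q → x ∉ q
x∈p─q⇒x∉q (_ ∷ _) (outside ∷ _) here          ()
x∈p─q⇒x∉q (_ ∷ p) (_ ∷ q)       (there x∈p─q) (there x∈q) = x∈p─q⇒x∉q p q x∈p─q x∈q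

-- A failed inclusion carries no witness by itself. Deciding whether `p ∩ q` is strictly contained
-- in `p` yields one, since a positive answer contains an element.
p⊈q⇒∃∈∉ : (p q : Subset n) → p ⊈ q → ∃[ x ] x ∈ p × x ∉ q
p⊈q⇒∃∈∉ p q p⊈q with Subset._⊂?_ (p ∩ q) p
... | yes (_ , x , x∈p , x∉p∩q) = x , x∈p , λ x∈q → x∉p∩q (Subset.x∈p∩q⁺ (x∈p , x∈q))
... | no p∩q⊄p = ⊥-elim (p⊈q λ {x} x∈p → decidable-stable (x Subset.∈? q) λ x∉q →
  p∩q⊄p (Subset.p∩q⊆p p q , x , x∈p , x∉q ∘ Subset.p∩q⊆q p q))

∪-lub : {p q r : Subset n} → p ⊆ r → q ⊆ r → p ∪ q ⊆ r
∪-lub {p = p} {q} p⊆r q⊆r x∈p∪q = [ p⊆r , q⊆r ]′ (Subset.x∈p∪q⁻ p q x∈p∪q)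

⁅⁆⊆ : {p : Subset n} {x : Fin n} → x ∈ p → ⁅ x ⁆ ⊆ p
⁅⁆⊆ {p = p} {x} x∈p y∈⁅x⁆ = subst (_∈ p) (≡.sym (Subset.x∈⁅y⁆⇒x≡y x y∈⁅x⁆)) x∈p

module _ (M : Matroid n) where
  open Matroid M

  rank-∪⁅⁆ : ∀ A e → rank (A ∪ ⁅ e ⁆) ≤ suc (rank A)
  rank-∪⁅⁆ A e = begin
    rank (A ∪ ⁅ e ⁆)                       ≤⟨ ℕ.m≤m+n _ _ ⟩
    rank (A ∪ ⁅ e ⁆) + rank (A ∩ ⁅ e ⁆)    ≤⟨ rank-submodular A ⁅ e ⁆ ⟩
    rank A + rank ⁅ e ⁆                    ≤⟨ ℕ.+-monoʳ-≤ (rank A) (rank-≤ ⁅ e ⁆) ⟩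
    rank A + ∣ ⁅ e ⁆ ∣                     ≡⟨ cong (rank A +_) (Subset.∣⁅x⁆∣≡1 e) ⟩
    rank A + 1                             ≡⟨ ℕ.+-comm (rank A) 1 ⟩
    suc (rank A)                           ∎
    where open ℕ.≤-Reasoning

  -- The elements of `es` are absorbed into `A` one after the other; by submodularity an element
  -- that does not raise the rank of `A` does not raise it after an enlargement of `A` either.
  rank-dependent : ∀ A (B : Subset n) (es : List (Fin n)) →
    (∀ {e} → e ∈ B → e ∈ A ⊎ e ∈ˡ es) → All (λ e → rank (A ∪ ⁅ e ⁆) ≡ rank A) es → rank B ≤ rank A
  rank-dependent A B [] B⊆A [] = rank-mono λ e∈B → [ id , (λ ()) ]′ (B⊆A e∈B)
  rank-dependent A B (f ∷ es) B⊆ (p ∷ ps) = ℕ.≤-trans (rank-dependent (A ∪ ⁅ f ⁆) B es cover (All.map step ps)) (ℕ.≤-reflexive p)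
    where
    cover : ∀ {e} → e ∈ B → e ∈ A ∪ ⁅ f ⁆ ⊎ e ∈ˡ es
    cover e∈B with B⊆ e∈B
    ... | inj₁ e∈A = inj₁ (Subset.p⊆p∪q ⁅ f ⁆ e∈A)
    ... | inj₂ (here refl) = inj₁ (Subset.q⊆p∪q A ⁅ f ⁆ (Subset.x∈⁅x⁆ f))
    ... | inj₂ (there e∈es) = inj₂ e∈es
    -- Submodularity is applied to `A ∪ ⁅ f ⁆` and `A ∪ ⁅ e ⁆`, whose intersection contains `A`.
    step : ∀ {e} → rank (A ∪ ⁅ e ⁆) ≡ rank A → rank ((A ∪ ⁅ f ⁆) ∪ ⁅ e ⁆) ≡ rank (A ∪ ⁅ f ⁆)
    step {e} q = ℕ.≤-antisym (ℕ.+-cancelʳ-≤ (rank A) _ _ (begin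
      rank ((A ∪ ⁅ f ⁆) ∪ ⁅ e ⁆) + rank A
        ≤⟨ ℕ.+-mono-≤
          (rank-mono (∪-lub (Subset.p⊆p∪q (A ∪ ⁅ e ⁆)) (Subset.q⊆p∪q (A ∪ ⁅ f ⁆) (A ∪ ⁅ e ⁆) ∘ Subset.q⊆p∪q A ⁅ e ⁆)))
          (rank-mono λ x∈A → Subset.x∈p∩q⁺ (Subset.p⊆p∪q ⁅ f ⁆ x∈A , Subset.p⊆p∪q ⁅ e ⁆ x∈A)) ⟩
      rank ((A ∪ ⁅ f ⁆) ∪ (A ∪ ⁅ e ⁆)) + rank ((A ∪ ⁅ f ⁆) ∩ (A ∪ ⁅ e ⁆))
        ≤⟨ rank-submodular _ _ ⟩
      rank (A ∪ ⁅ f ⁆) + rank (A ∪ ⁅ e ⁆)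
        ≡⟨ cong (rank (A ∪ ⁅ f ⁆) +_) q ⟩
      rank (A ∪ ⁅ f ⁆) + rank A ∎))
      (rank-mono (Subset.p⊆p∪q ⁅ e ⁆))
      where open ℕ.≤-Reasoning


  closure : Subset n → Subset n
  closure A = tabulate λ e → does (rank (A ∪ ⁅ e ⁆) ℕ.≟ rank A)

  ∈-closure⁺ : ∀ {A e} → rank (A ∪ ⁅ e ⁆) ≡ rank A → e ∈ closure A
  ∈-closure⁺ {e = e} p = Vec.lookup⇒[]= e _ (≡.trans (Vec.lookup∘tabulate _ e) (dec-true (_ ℕ.≟ _) p))

  ∈-closure⁻ : ∀ {A e} → e ∈ closure A → rank (A ∪ ⁅ e ⁆) ≡ rank A
  ∈-closure⁻ {A} {e} e∈cl = ℕ.≡ᵇ⇒≡ _ _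
    (subst Bool.T (≡.sym (≡.trans (≡.sym (Vec.lookup∘tabulate _ e)) (Vec.[]=⇒lookup e∈cl))) _)

  ⊆-closure : ∀ A → A ⊆ closure A
  ⊆-closure A x∈A = ∈-closure⁺ (ℕ.≤-antisym (rank-mono (∪-lub id (⁅⁆⊆ x∈A))) (rank-mono (Subset.p⊆p∪q _)))

  rank-closure : ∀ A → rank (closure A) ≡ rank A
  rank-closure A = ℕ.≤-antisym
    (rank-dependent A (closure A) (filter (λ e → rank (A ∪ ⁅ e ⁆) ℕ.≟ rank A) (allFin n))
      (λ {e} e∈cl → inj₂ (∈-filter⁺ _ (∈-allFin e) (∈-closure⁻ e∈cl)))
      (All.all-filter _ (allFin n)))
    (rank-mono (⊆-closure A))

  -- An element outside the closure already raises the rank of `A`, and `A` has the same rank as its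
  -- closure.
  closure-isFlat : ∀ A → IsFlat M (closure A)
  closure-isFlat A e e∉cl = begin-strict
    rank (closure A)            ≡⟨ rank-closure A ⟩
    rank A                      <⟨ ℕ.≤∧≢⇒< (rank-mono (Subset.p⊆p∪q ⁅ e ⁆)) (e∉cl ∘ ∈-closure⁺ ∘ ≡.sym) ⟩
    rank (A ∪ ⁅ e ⁆)            ≤⟨ rank-mono (∪-lub (Subset.p⊆p∪q ⁅ e ⁆ ∘ ⊆-closure A) (Subset.q⊆p∪q (closure A) ⁅ e ⁆)) ⟩
    rank (closure A ∪ ⁅ e ⁆)    ∎
    where open ℕ.≤-Reasoning

-- Hyperplanes over a flat of corank 2

module _ {M : Matroid n} where
  open Matroid M

  -- The irrelevant proof stored in `H` is recovered by deciding the property again.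
  isHyperplane : (H : Hyperplane M) → IsFlatOfCorank M 1 (set H)
  isHyperplane (A , p) = recompute (isFlatOfCorank? M 1 A) p

  hyperplane-≡ : {H H′ : Hyperplane M} → set H ≡ set H′ → H ≡ H′
  hyperplane-≡ refl = refl

  -- An element of `H′` outside `H` would raise the rank of `H` above that of `H′`, but all
  -- hyperplanes have the same rank.
  hyperplane-maximal : (H H′ : Hyperplane M) → set H ⊆ set H′ → set H′ ⊆ set H
  hyperplane-maximal H H′ H⊆H′ {e} e∈H′ = decidable-stable (e Subset.∈? set H) λ e∉H → ℕ.<-irrefl
    (ℕ.+-cancelʳ-≡ 1 _ _ (≡.trans (proj₂ (isHyperplane H)) (≡.sym (proj₂ (isHyperplane H′)))))
    (ℕ.≤-trans (proj₁ (isHyperplane H) e e∉H) (rank-mono (∪-lub H⊆H′ (⁅⁆⊆ e∈H′))))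

  module _ {L : Subset n} (L-corank2 : IsFlatOfCorank M 2 L) where

    rank-hyperplane : (H : Hyperplane M) → rank (set H) ≡ suc (rank L)
    rank-hyperplane H = ℕ.+-cancelʳ-≡ 1 _ _ (begin
      rank (set H) + 1    ≡⟨ proj₂ (isHyperplane H) ⟩
      rank ⊤              ≡⟨ proj₂ L-corank2 ⟨
      rank L + 2          ≡⟨ ℕ.+-suc (rank L) 1 ⟩
      suc (rank L) + 1    ∎)
      where open ≡.≡-Reasoning

    hyperplane∖corank2 : (H : Hyperplane M) → ∃[ e ] e ∈ set H × e ∉ L
    hyperplane∖corank2 H = p⊈q⇒∃∈∉ (set H) L λ H⊆L →
      ℕ.1+n≰n (ℕ.≤-trans (ℕ.≤-reflexive (≡.sym (rank-hyperplane H))) (rank-mono H⊆L))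

    -- Suppose that a common element `e` lies outside `L`. Then the intersection has larger rank
    -- than `L`, and an element of `H₂` outside `H₁` would make the union have larger rank than
    -- `H₁`, which together violate submodularity. So `H₂ ⊆ H₁`, and the hyperplanes coincide by
    -- maximality.
    hyperplanes-∩ : {H₁ H₂ : Hyperplane M} → H₁ ≢ H₂ → L ⊆ set H₁ → L ⊆ set H₂ →
                    ∀ {e} → e ∈ set H₁ → e ∈ set H₂ → e ∈ L
    hyperplanes-∩ {H₁} {H₂} H₁≢H₂ L⊆H₁ L⊆H₂ {e} e∈H₁ e∈H₂ = decidable-stable (e Subset.∈? L) λ e∉L →
      H₁≢H₂ (hyperplane-≡ (Subset.⊆-antisym (hyperplane-maximal H₂ H₁ (H₂⊆H₁ e∉L)) (H₂⊆H₁ e∉L)))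
      where
      open ℕ.≤-Reasoning
      H₂⊆H₁ : e ∉ L → set H₂ ⊆ set H₁
      H₂⊆H₁ e∉L {f} f∈H₂ = decidable-stable (f Subset.∈? set H₁) λ f∉H₁ → ℕ.<-irrefl refl (begin-strict
        rank (set H₁) + rank (set H₂)
          ≡⟨ cong (rank (set H₁) +_) (rank-hyperplane H₂) ⟩
        rank (set H₁) + suc (rank L)
          <⟨ ℕ.+-mono-<-≤ (proj₁ (isHyperplane H₁) f f∉H₁) (proj₁ L-corank2 e e∉L) ⟩
        rank (set H₁ ∪ ⁅ f ⁆) + rank (L ∪ ⁅ e ⁆)
          ≤⟨ ℕ.+-mono-≤ (rank-mono (∪-lub (Subset.p⊆p∪q (set H₂)) (Subset.q⊆p∪q (set H₁) (set H₂) ∘ ⁅⁆⊆ f∈H₂)))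
                        (rank-mono (∪-lub (λ x∈L → Subset.x∈p∩q⁺ (L⊆H₁ x∈L , L⊆H₂ x∈L))
                                          (λ x∈e → Subset.x∈p∩q⁺ (⁅⁆⊆ e∈H₁ x∈e , ⁅⁆⊆ e∈H₂ x∈e)))) ⟩
        rank (set H₁ ∪ set H₂) + rank (set H₁ ∩ set H₂)
          ≤⟨ rank-submodular (set H₁) (set H₂) ⟩
        rank (set H₁) + rank (set H₂) ∎)

    -- The closure of `L ∪ ⁅ e ⁆` works, because adding `e` raises the rank of the flat `L` by
    -- exactly one. It serves as the fourth hyperplane in (T2).
    hyperplane-through : ∀ {e} → e ∉ L → Σ[ H ∈ Hyperplane M ] L ⊆ set H × e ∈ set H
    hyperplane-through {e} e∉L =
      (closure M (L ∪ ⁅ e ⁆) , closure-isFlat M _ , (begin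
        rank (closure M (L ∪ ⁅ e ⁆)) + 1    ≡⟨ cong (_+ 1) (rank-closure M _) ⟩
        rank (L ∪ ⁅ e ⁆) + 1                ≡⟨ cong (_+ 1) (ℕ.≤-antisym (rank-∪⁅⁆ M L e) (proj₁ L-corank2 e e∉L)) ⟩
        suc (rank L) + 1                    ≡⟨ ℕ.+-suc (rank L) 1 ⟨
        rank L + 2                          ≡⟨ proj₂ L-corank2 ⟩
        rank ⊤                              ∎))
      , (λ x∈L → ⊆-closure M _ (Subset.p⊆p∪q ⁅ e ⁆ x∈L))
      , ⊆-closure M _ (Subset.q⊆p∪q L ⁅ e ⁆ (Subset.x∈⁅x⁆ e))
      where open ≡.≡-Reasoning

x∈⋂⁺ : {x : Fin n} {ps : List (Subset n)} → All (x ∈_) ps → x ∈ ⋂ ps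
x∈⋂⁺ [] = Subset.∈⊤
x∈⋂⁺ (x∈p ∷ x∈ps) = Subset.x∈p∩q⁺ (x∈p , x∈⋂⁺ x∈ps)

x∈⋂⁻ : {x : Fin n} (ps : List (Subset n)) → x ∈ ⋂ ps → All (x ∈_) ps
x∈⋂⁻ [] _ = []
x∈⋂⁻ (p ∷ ps) x∈⋂ = let x∈p , x∈ps = Subset.x∈p∩q⁻ p (⋂ ps) x∈⋂ in x∈p ∷ x∈⋂⁻ ps x∈ps

-- Forests and potentials

module _ {A : Set} {R : Rel A 0ℓ} where

  linked-split : ∀ xs {v ys} → Linked R (xs ++ v ∷ ys) → Linked R (xs ++ v ∷ []) × Linked R (v ∷ ys)
  linked-split []           l = [-] , l
  linked-split (x ∷ [])     (r ∷ l) = r ∷ [-] , l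
  linked-split (x ∷ y ∷ xs) (r ∷ l) = let l₁ , l₂ = linked-split (y ∷ xs) l in r ∷ l₁ , l₂

  linked-join : ∀ xs {v ys} → Linked R (xs ++ v ∷ []) → Linked R (v ∷ ys) → Linked R (xs ++ v ∷ ys)
  linked-join []           _       l = l
  linked-join (x ∷ [])     (r ∷ _) l = r ∷ l
  linked-join (x ∷ y ∷ xs) (r ∷ k) l = r ∷ linked-join (y ∷ xs) k l

  data Path : A → A → List A → Set where
    [_] : ∀ v → Path v v (v ∷ [])
    _∷_ : ∀ {u v w vs} → R u v → Path v w vs → Path u w (u ∷ vs)

  path-suffix : ∀ {u v w vs} → Unique vs → Path v w vs → u ∈ˡ vs → ∃[ us ] Unique us × Path u w us
  path-suffix vs! p@([ _ ]) (here refl) = _ , vs! , p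
  path-suffix vs! p@(_ ∷ _) (here refl) = _ , vs! , p
  path-suffix (_ ∷ vs!) (_ ∷ p) (there u∈vs) = path-suffix vs! p u∈vs

  -- Loop erasure: if the first vertex recurs on the simple path built from the rest of the walk,
  -- only the part of that path from its recurrence on is kept.
  simplePath : DecidableEquality A → ∀ {v w} → Star R v w → ∃[ vs ] Unique vs × Path v w vs
  simplePath _≟_ {v} ε = _ , [] ∷ [] , [ v ]
  simplePath _≟_ {v} (r ◅ rs) with simplePath _≟_ rs
  ... | vs , vs! , p with DecMembership._∈?_ _≟_ v vs
  ...   | yes v∈vs = path-suffix vs! p v∈vs
  ...   | no  v∉vs = _ , All.¬Any⇒All¬ _ v∉vs ∷ vs! , r ∷ p

  -- Produces the `closed` field of a cycle. The closing step may use an edge outside `R`, hence the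
  -- larger relation `S`.
  closePath : {S : Rel A 0ℓ} → R ⇒ S → ∀ {u v w vs} → Path v w vs → S w u → Linked S (vs ++ u ∷ [])
  closePath R⇒S [ _ ]             s = s ∷ [-]
  closePath R⇒S (r ∷ p@([ _ ]))   s = R⇒S r ∷ closePath R⇒S p s
  closePath R⇒S (r ∷ p@(_ ∷ _))   s = R⇒S r ∷ closePath R⇒S p s

  path-nonempty : ∀ {v w vs} → Path v w vs → 1 ≤ length vs
  path-nonempty [ _ ]   = s≤s z≤n
  path-nonempty (_ ∷ _) = s≤s z≤n

-- Walks, cycles and components in the incidence graph

module _ {M : Matroid n} where

  _≟ⱽ_ : DecidableEquality (Vertex M)
  _≟ⱽ_ = Sum.≡-dec _≟ᴴ_ Fin._≟_

  adjacent-mono : {F F′ : EdgeSet M} → F ⊆ᴾ F′ → Adjacent F ⇒ Adjacent F′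
  adjacent-mono F⊆F′ (forwards p)  = forwards (F⊆F′ p)
  adjacent-mono F⊆F′ (backwards p) = backwards (F⊆F′ p)

  acyclic-antimono : {F F′ : EdgeSet M} → F ⊆ᴾ F′ → Acyclic F′ → Acyclic F
  acyclic-antimono F⊆F′ acyclic C = acyclic record
    { Cycle C hiding (closed)
    ; closed = Linked.map (adjacent-mono F⊆F′) (Cycle.closed C) }

  -- Lets a cycle through a vertex be assumed to start there, so that an edge at this vertex can
  -- occur only at the two ends of the vertex list.
  rotate : {F : EdgeSet M} (C : Cycle F) → ∀ {v} → v ∈ˡ (Cycle.start C ∷ Cycle.rest C) →
           Σ[ C′ ∈ Cycle F ] Cycle.start C′ ≡ v
  rotate {F} C {v} v∈C = go (∈-∃++ v∈C) distinct long closed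
    where
    open Cycle C
    go : ∃[ xs ] ∃[ ys ] start ∷ rest ≡ xs ++ v ∷ ys → Unique (start ∷ rest) → 3 ≤ length (start ∷ rest) →
         Linked (Adjacent F) (start ∷ rest ++ start ∷ []) → Σ[ C′ ∈ Cycle F ] Cycle.start C′ ≡ v
    go ([] , ys , refl) _ _ _ = C , refl
    go (_ ∷ xs , ys , refl) d l k = record
      { start = v
      ; rest = ys ++ start ∷ xs
      ; distinct = Permutationₛ.Unique-resp-↭ (≡.setoid _) (↭⇒↭ₛ (++-comm (start ∷ xs) (v ∷ ys))) d
      ; long = subst (3 ≤_) (↭-length (++-comm (start ∷ xs) (v ∷ ys))) l
      ; closed = subst (Linked _) (cong (v ∷_) (≡.sym (List.++-assoc ys (start ∷ xs) (v ∷ []))))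
          (linked-join (v ∷ ys) (proj₂ k₂) (proj₁ k₂)) } , refl
      where
      k₂ : Linked (Adjacent F) (start ∷ xs ++ v ∷ []) × Linked (Adjacent F) (v ∷ ys ++ start ∷ [])
      k₂ = linked-split (start ∷ xs) (subst (Linked _) (cong (start ∷_) (List.++-assoc xs (v ∷ ys) (start ∷ []))) k)

  -- A simple path from `H` to `e` is either the single edge `(H , e)`, which is not in `F`, or has
  -- at least three vertices and is closed to a cycle of `F′` by that edge.
  acyclic⇒no-detour : {F F′ : EdgeSet M} → F ⊆ᴾ F′ → Acyclic F′ → ∀ {H e} → (H , e) ∈ᴾ F′ → ¬ (H , e) ∈ᴾ F →
                      ¬ Star (Adjacent F) (inj₁ H) (inj₂ e)
  acyclic⇒no-detour {F} {F′} F⊆F′ acyclic {H} {e} He∈F′ He∉F walk = go (simplePath _≟ⱽ_ walk)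
    where
    go : ¬ (∃[ vs ] Unique vs × Path {R = Adjacent F} (inj₁ H) (inj₂ e) vs)
    go (_ , _ , (forwards He∈F ∷ [ _ ])) = He∉F He∈F
    go (_ , vs! , p@(_ ∷ (_ ∷ q))) = acyclic record
      { start    = inj₁ H
      ; rest     = _
      ; distinct = vs!
      ; long     = s≤s (s≤s (path-nonempty q))
      ; closed   = closePath (adjacent-mono F⊆F′) p (backwards He∈F′) }

  -- The connected components of `F` in decidable form: each vertex is labelled by a vertex that
  -- stands for its component, so that comparing labels decides connectedness.
  record Labelling (F : EdgeSet M) : Set where
    field
      label           : Vertex M → Vertex M
      label-adjacent  : ∀ {v w} → Adjacent F v w → label v ≡ label w
      label-connected : ∀ {v w} → label v ≡ label w → Star (Adjacent F) v w

  -- Adding an edge merges two components: the label of `e` is replaced everywhere by that of `H`.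
  labelling : (es : List (Hyperplane M × Fin n)) → Labelling (_∈ˡ es)
  labelling [] = record
    { label           = id
    ; label-adjacent  = λ { (forwards ()) ; (backwards ()) }
    ; label-connected = λ { refl → ε } }
  labelling ((H , e) ∷ es) = record
    { label           = relabel ∘ label
    ; label-adjacent  = relabel-adjacent
    ; label-connected = relabel-connected }
    where
    open Labelling (labelling es)
    relabel : Vertex M → Vertex M
    relabel v with v ≟ⱽ label (inj₂ e)
    ... | yes _ = label (inj₁ H)
    ... | no  _ = v
    relabel-H : relabel (label (inj₁ H)) ≡ label (inj₁ H)
    relabel-H with label (inj₁ H) ≟ⱽ label (inj₂ e)
    ... | yes _ = refl
    ... | no  _ = refl
    relabel-e : relabel (label (inj₂ e)) ≡ label (inj₁ H)
    relabel-e with label (inj₂ e) ≟ⱽ label (inj₂ e)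
    ... | yes _   = refl
    ... | no  e≢e = contradiction refl e≢e
    relabel-adjacent : ∀ {v w} → Adjacent (_∈ˡ ((H , e) ∷ es)) v w → relabel (label v) ≡ relabel (label w)
    relabel-adjacent (forwards (here refl))  = ≡.trans relabel-H (≡.sym relabel-e)
    relabel-adjacent (forwards (there p))    = cong relabel (label-adjacent (forwards p))
    relabel-adjacent (backwards (here refl)) = ≡.trans relabel-e (≡.sym relabel-H)
    relabel-adjacent (backwards (there p))   = cong relabel (label-adjacent (backwards p))
    Connected : Rel (Vertex M) 0ℓ
    Connected = Star (Adjacent (_∈ˡ ((H , e) ∷ es)))
    connected : ∀ {v w} → label v ≡ label w → Connected v w
    connected p = Star.map (adjacent-mono there) (label-connected p)
    relabel-connected : ∀ {v w} → relabel (label v) ≡ relabel (label w) → Connected v w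
    relabel-connected {v} {w} p with label v ≟ⱽ label (inj₂ e) | label w ≟ⱽ label (inj₂ e)
    ... | yes v~e | yes w~e = connected (≡.trans v~e (≡.sym w~e))
    -- Here `p` equates the label of `H` with that of `w`, so the route goes from `v` to `e`, over
    -- the new edge to `H`, and on to `w`.
    ... | yes v~e | no  _   = connected v~e ◅◅ backwards (here refl) ◅ connected p
    ... | no  _   | yes w~e = connected p ◅◅ forwards (here refl) ◅ connected (≡.sym w~e)
    ... | no  _   | no  _   = connected p

  -- Adding an edge to a forest

  module _ {F : EdgeSet M} (𝓛 : Labelling F) {H : Hyperplane M} {e : Fin n} where
    open Labelling 𝓛

    insert : EdgeSet M
    insert He′ = He′ ∈ᴾ F ⊎ He′ ≡ (H , e)

    insert-step : ∀ {v w} → Adjacent insert v w →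
      Adjacent F v w ⊎ (v ≡ inj₁ H × w ≡ inj₂ e) ⊎ (v ≡ inj₂ e × w ≡ inj₁ H)
    insert-step (forwards (inj₁ p))     = inj₁ (forwards p)
    insert-step (forwards (inj₂ refl))  = inj₂ (inj₁ (refl , refl))
    insert-step (backwards (inj₁ p))    = inj₁ (backwards p)
    insert-step (backwards (inj₂ refl)) = inj₂ (inj₂ (refl , refl))

    avoiding-H : ∀ {v w} → inj₁ H ≢ v → inj₁ H ≢ w → Adjacent insert v w → Adjacent F v w
    avoiding-H H≢v H≢w a with insert-step a
    ... | inj₁ a′ = a′
    ... | inj₂ (inj₁ (v≡H , _)) = contradiction (≡.sym v≡H) H≢v
    ... | inj₂ (inj₂ (_ , w≡H)) = contradiction (≡.sym w≡H) H≢w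

    linked-avoiding-H : ∀ {vs} → All (inj₁ H ≢_) vs → Linked (Adjacent insert) vs → Linked (Adjacent F) vs
    linked-avoiding-H _ [] = []
    linked-avoiding-H _ [-] = [-]
    linked-avoiding-H (H≢v ∷ H≢@(H≢w ∷ _)) (a ∷ l) = avoiding-H H≢v H≢w a ∷ linked-avoiding-H H≢ l

    -- All steps before the last avoid `H`, so they lie in `F` and preserve labels. The last step
    -- either lies in `F` as well or is the new edge, and then it starts at `e`.
    return-to-H : ∀ v vs → All (inj₁ H ≢_) (v ∷ vs) → Linked (Adjacent insert) (v ∷ vs ++ inj₁ H ∷ []) →
      (label v ≡ label (inj₁ H) × Linked (Adjacent F) (v ∷ vs ++ inj₁ H ∷ [])) ⊎
      (label v ≡ label (inj₂ e) × inj₂ e ∈ˡ (v ∷ vs))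
    return-to-H v [] (H≢v ∷ []) (a ∷ [-]) with insert-step a
    ... | inj₁ a′                = inj₁ (label-adjacent a′ , a′ ∷ [-])
    ... | inj₂ (inj₁ (v≡H , _))  = contradiction (≡.sym v≡H) H≢v
    ... | inj₂ (inj₂ (refl , _)) = inj₂ (refl , here refl)
    return-to-H v (w ∷ vs) (H≢v ∷ H≢@(H≢w ∷ _)) (a ∷ l) with avoiding-H H≢v H≢w a | return-to-H w vs H≢ l
    ... | a′ | inj₁ (p , l′)   = inj₁ (≡.trans (label-adjacent a′) p , a′ ∷ l′)
    ... | a′ | inj₂ (p , e∈vs) = inj₂ (≡.trans (label-adjacent a′) p , there e∈vs)

    -- Labels change only along the new edge, which a cycle through H uses at most once.
    insert-acyclic : label (inj₁ H) ≢ label (inj₂ e) → Acyclic F → Acyclic insert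
    insert-acyclic H≁e acyclic C with DecMembership._∈?_ _≟ⱽ_ (inj₁ H) (Cycle.start C ∷ Cycle.rest C)
    ... | no H∉C = acyclic record
      { Cycle C hiding (closed)
      ; closed = linked-avoiding-H (All.++⁺ H≢C (All.head H≢C ∷ [])) (Cycle.closed C) }
      where
      H≢C : All (inj₁ H ≢_) (Cycle.start C ∷ Cycle.rest C)
      H≢C = All.¬Any⇒All¬ _ H∉C
    ... | yes H∈C with rotate C H∈C
    ...   | C′ , refl = go (Cycle.rest C′) (Cycle.distinct C′) (Cycle.long C′) (Cycle.closed C′)
      where
      go : ∀ vs → Unique (inj₁ H ∷ vs) → 3 ≤ length (inj₁ H ∷ vs) →
           Linked (Adjacent insert) (inj₁ H ∷ vs ++ inj₁ H ∷ []) → ⊥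
      go (_ ∷ []) _ (s≤s (s≤s ())) _
      go (v ∷ w ∷ vs) d@((H≢@(H≢v ∷ H≢ws@(H≢w ∷ _))) ∷ (v≢ws ∷ _)) _ (a ∷ l@(b ∷ k)) with insert-step a
      ... | inj₂ (inj₂ (() , _))
      ... | inj₁ a′ with return-to-H v (w ∷ vs) H≢ l
      ...   | inj₁ (_ , l′) = acyclic record
        { start = inj₁ H ; rest = v ∷ w ∷ vs ; distinct = d ; long = s≤s (s≤s (s≤s z≤n)) ; closed = a′ ∷ l′ }
      ...   | inj₂ (v~e , _) = H≁e (≡.trans (label-adjacent a′) v~e)
      -- The cycle leaves `H` along the new edge, so `v` is `e`. Returning within `F` would give `e`
      -- and `H` the same label; returning by the new edge would visit `e` twice.
      go (v ∷ w ∷ vs) d@((H≢@(H≢v ∷ H≢ws@(H≢w ∷ _))) ∷ (v≢ws ∷ _)) _ (a ∷ l@(b ∷ k)) | inj₂ (inj₁ (_ , refl))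
        with avoiding-H H≢v H≢w b | return-to-H w vs H≢ws k
      ...   | b′ | inj₁ (w~H , _)  = H≁e (≡.sym (≡.trans (label-adjacent b′) w~H))
      ...   | _  | inj₂ (_ , e∈ws) = All.All¬⇒¬Any v≢ws e∈ws

  module _ {F : EdgeSet M} (spanning : IsSpanningForest M F) (𝓛 : Labelling F) where
    open Labelling 𝓛
    open IsSpanningForest spanning

    -- If the ends of an edge had different labels, the edge could be added to `F` without creating
    -- a cycle, so by maximality it belongs to `F` already.
    spanning⇒connected : ∀ {H e} → (H , e) ∈ᴾ incidenceGraph M → Star (Adjacent F) (inj₁ H) (inj₂ e)
    spanning⇒connected {H} {e} e∉H with label (inj₁ H) ≟ⱽ label (inj₂ e)
    ... | yes H~e = label-connected H~e
    ... | no H≁e  = forwards (maximal (λ { (inj₁ p) → edges p ; (inj₂ refl) → e∉H })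
      (insert-acyclic 𝓛 H≁e acyclic) inj₁ (inj₂ refl)) ◅ ε

  labelling-resp : {F F′ : EdgeSet M} → F ⊆ᴾ F′ → F′ ⊆ᴾ F → Labelling F → Labelling F′
  labelling-resp F⊆F′ F′⊆F 𝓛 = record
    { label           = label
    ; label-adjacent  = label-adjacent ∘ adjacent-mono F′⊆F
    ; label-connected = Star.map (adjacent-mono F⊆F′) ∘ label-connected }
    where open Labelling 𝓛

  -- Potentials on a forest

  module _ (G : AbelianGroup c ℓ) (w : Hyperplane M → Fin n → AbelianGroup.Carrier G) where
    open AbelianGroup G hiding (ε; refl) renaming (_∙_ to _·_)
    open SetoidReasoning setoid

    -- For `w = φ` the factors a_H = p(H) and t_e = p(e)⁻¹ rescale φ to 1 on `F`.
    Potential : EdgeSet M → Set _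
    Potential F = Σ[ p ∈ (Vertex M → Carrier) ] (∀ {H e} → (H , e) ∈ᴾ F → p (inj₂ e) ≈ p (inj₁ H) · w H e)

    -- Induction on the edges. Acyclicity puts the ends of a new edge into different components of
    -- the earlier ones, so multiplying `p` by a constant on the component of `e` keeps the earlier
    -- equations.
    potential : (es : List (Hyperplane M × Fin n)) → Acyclic (_∈ˡ es) → Potential (_∈ˡ es)
    potential [] _ = (λ _ → AbelianGroup.ε G) , λ ()
    potential ((H , e) ∷ es) acyclic
      with potential es (acyclic-antimono there acyclic) | DecMembership._∈?_ (≡-dec _≟ᴴ_ Fin._≟_) (H , e) es
    -- The list may repeat an edge; its equation then holds already.
    ... | p , p-edge | yes He∈es = p , λ { (here refl) → p-edge He∈es ; (there i) → p-edge i }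
    ... | p , p-edge | no  He∉es = p′ , p′-edge
      where
      open Labelling (labelling es)
      -- The component of e is shifted so as to fit the new edge.
      shift : Carrier
      shift = p (inj₂ e) ⁻¹ · (p (inj₁ H) · w H e)
      p′ : Vertex M → Carrier
      p′ v with label v ≟ⱽ label (inj₂ e)
      ... | yes _ = shift · p v
      ... | no  _ = p v
      p′-edge : ∀ {H′ e′} → (H′ , e′) ∈ˡ ((H , e) ∷ es) → p′ (inj₂ e′) ≈ p′ (inj₁ H′) · w H′ e′
      p′-edge (here refl) with label (inj₁ H) ≟ⱽ label (inj₂ e) | label (inj₂ e) ≟ⱽ label (inj₂ e)
      ... | yes H~e | _      = contradiction (label-connected H~e) (acyclic⇒no-detour there acyclic (here refl) He∉es)
      ... | no _    | no e≁e = contradiction refl e≁e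
      ... | no _    | yes _  = begin
        p (inj₂ e) ⁻¹ · (p (inj₁ H) · w H e) · p (inj₂ e)      ≈⟨ comm _ _ ⟩
        p (inj₂ e) · (p (inj₂ e) ⁻¹ · (p (inj₁ H) · w H e))    ≈⟨ assoc _ _ _ ⟨
        p (inj₂ e) · p (inj₂ e) ⁻¹ · (p (inj₁ H) · w H e)      ≈⟨ ∙-congʳ (inverseʳ _) ⟩
        AbelianGroup.ε G · (p (inj₁ H) · w H e)                ≈⟨ identityˡ _ ⟩
        p (inj₁ H) · w H e                                     ∎
      p′-edge {H′} {e′} (there i) with label (inj₁ H′) ≟ⱽ label (inj₂ e) | label (inj₂ e′) ≟ⱽ label (inj₂ e)
      ... | yes _    | yes _    = trans (∙-congˡ (p-edge i)) (sym (assoc _ _ _))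
      ... | yes H′~e | no e′≁e  = contradiction (≡.trans (label-adjacent (backwards i)) H′~e) e′≁e
      ... | no H′≁e  | yes e′~e = contradiction (≡.trans (label-adjacent (forwards i)) e′~e) H′≁e
      ... | no _     | no _     = p-edge i

-- Linear dependencies in pastures

module PastureProperties (P : Pasture c ℓ ν) where
  open Pasture P
  open CommutativeMonoidSolver commutativeMonoid using (solve; _⊜_; _⊕_)
  open SetoidReasoning setoid

  -‿distribˡ-* : ∀ x y → - x * y ≈ - (x * y)
  -‿distribˡ-* x y = begin
    - x * y    ≈⟨ comm _ _ ⟩
    y * - x    ≈⟨ *-‿distribʳ y x ⟨
    - (y * x)  ≈⟨ -‿cong (comm y x) ⟩
    - (x * y)  ∎

  -x*-y≈x*y : ∀ x y → - x * - y ≈ x * y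
  -x*-y≈x*y x y = begin
    - x * - y      ≈⟨ -‿distribˡ-* x (- y) ⟩
    - (x * - y)    ≈⟨ -‿cong (*-‿distribʳ x y) ⟨
    - - (x * y)    ≈⟨ -‿involutive _ ⟩
    x * y          ∎

  Null-neg : ∀ {x y z} → Null x y z → Null (- x) (- y) (- z)
  Null-neg N = Null-resp (neg1 _) (neg1 _) (neg1 _) (Null-* (- 1#) N)
    where
    neg1 : ∀ x → - 1# * x ≈ - x
    neg1 x = ≈-trans (-‿distribˡ-* 1# x) (-‿cong (identityˡ x))

  Null-0 : Null 0# 0# 0#
  Null-0 = Null-resp (zeroˡ _) (zeroˡ _) (zeroˡ _) (Null-* 0# (-‿null 1#))

  Null⇒≈- : ∀ {x y} → Null x y 0# → y ≈ - x
  Null⇒≈- N = ≈-sym (-‿unique N)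

  Null-zero : ∀ {x y} → Null x y 0# → x ≈ 0# → y ≈ 0#
  Null-zero N x≈0 = ≈-trans (Null⇒≈- N) (-‿unique (Null-resp (≈-sym x≈0) ≈-refl ≈-refl Null-0))

  inverse-cancelˡ : ∀ {u v} → u * v ≈ 1# → ∀ x → v * (u * x) ≈ x
  inverse-cancelˡ {u} {v} uv≈1 x = begin
    v * (u * x)  ≈⟨ assoc v u x ⟨
    v * u * x    ≈⟨ ∙-congʳ (≈-trans (comm v u) uv≈1) ⟩
    1# * x       ≈⟨ identityˡ x ⟩
    x            ∎

  *-cancelˡ : ∀ {u x y} → u ≉ 0# → u * x ≈ u * y → x ≈ y
  *-cancelˡ {u} {x} {y} u≉0 ux≈uy with v , uv≈1 ← invertible u≉0 = begin
    x              ≈⟨ inverse-cancelˡ uv≈1 x ⟨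
    v * (u * x)    ≈⟨ ∙-congˡ ux≈uy ⟩
    v * (u * y)    ≈⟨ inverse-cancelˡ uv≈1 y ⟩
    y              ∎

  Null-cancel : ∀ {u x y z} → u ≉ 0# → Null (u * x) (u * y) (u * z) → Null x y z
  Null-cancel u≉0 N with v , uv≈1 ← invertible u≉0 =
    Null-resp (inverse-cancelˡ uv≈1 _) (inverse-cancelˡ uv≈1 _) (inverse-cancelˡ uv≈1 _) (Null-* v N)

  Null-cross : ∀ {x y x′ y′} → Null x y 0# → Null x′ y′ 0# → x * y′ ≈ x′ * y
  Null-cross {x} {y} {x′} {y′} N N′ = begin
    x * y′        ≈⟨ ∙-congˡ (Null⇒≈- N′) ⟩
    x * - x′      ≈⟨ *-‿distribʳ x x′ ⟨
    - (x * x′)    ≈⟨ -‿cong (comm x x′) ⟩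
    - (x′ * x)    ≈⟨ *-‿distribʳ x′ x ⟩
    x′ * - x      ≈⟨ ∙-congˡ (Null⇒≈- N) ⟨
    x′ * y        ∎

  -- Each `y` is the negative of the corresponding `x`, and of three signs two cancel.
  Null-product : ∀ {x y x′ y′ x″ y″} → Null x y 0# → Null x′ y′ 0# → Null x″ y″ 0# →
                 Null (x * x′ * x″) (y * y′ * y″) 0#
  Null-product {x} {y} {x′} {y′} {x″} {y″} N N′ N″ = Null-resp
    (solve 3 (λ x x′ x″ → ((x′ ⊕ x″) ⊕ x) ⊜ ((x ⊕ x′) ⊕ x″)) ≈-refl x x′ x″)
    (begin
      x′ * x″ * y        ≈⟨ ∙-congʳ (-x*-y≈x*y x′ x″) ⟨
      - x′ * - x″ * y    ≈⟨ ∙-congʳ (∙-cong (Null⇒≈- N′) (Null⇒≈- N″)) ⟨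
      y′ * y″ * y        ≈⟨ solve 3 (λ y y′ y″ → ((y′ ⊕ y″) ⊕ y) ⊜ ((y ⊕ y′) ⊕ y″)) ≈-refl y y′ y″ ⟩
      y * y′ * y″        ∎)
    (zeroʳ _)
    (Null-* (x′ * x″) N)

  -- Here yᵢⱼ stands for φ_{Hᵢ}(aⱼ), and a, b, c for the coefficients of a dependency.
  module _ {a b c y₁₂ y₁₃ y₂₁ y₂₃ y₃₁ y₃₂ : Carrier}
           (N₁ : Null (c * y₃₁) (b * y₂₁) 0#) (N₂ : Null (a * y₁₂) (c * y₃₂) 0#) (N₃ : Null (b * y₂₃) (a * y₁₃) 0#) where

    -- The three binary relations are multiplied, and the common factor `a * b * c` is cancelled.
    dependency⇒T₁ : a ≉ 0# → b ≉ 0# → c ≉ 0# → Null (y₁₂ * y₂₃ * y₃₁) (y₁₃ * y₂₁ * y₃₂) 0#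
    dependency⇒T₁ a≉0 b≉0 c≉0 = Null-cancel (*-nonzero (*-nonzero a≉0 b≉0) c≉0) (Null-resp
      (solve 6 (λ a b c x y z → ((a ⊕ x) ⊕ (b ⊕ y)) ⊕ (c ⊕ z) ⊜ ((a ⊕ b) ⊕ c) ⊕ ((x ⊕ y) ⊕ z)) ≈-refl a b c y₁₂ y₂₃ y₃₁)
      (solve 6 (λ a b c x y z → ((c ⊕ z) ⊕ (a ⊕ x)) ⊕ (b ⊕ y) ⊜ ((a ⊕ b) ⊕ c) ⊕ ((x ⊕ y) ⊕ z)) ≈-refl a b c y₁₃ y₂₁ y₃₂)
      (≈-sym (zeroʳ _))
      (Null-product N₂ N₃ N₁))

    -- The dependency is multiplied by -(y₂₃ y₃₂). Then `N₃` and `N₂` replace b y₂₃ by -(a y₁₃) and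
    -- c y₃₂ by -(a y₁₂), and `a` is cancelled.
    dependency⇒T₂ : a ≉ 0# → ∀ {y₁₄ y₂₄ y₃₄} → Null (a * y₁₄) (b * y₂₄) (c * y₃₄) →
      Null (y₁₃ * y₂₄ * y₃₂) (y₁₂ * y₃₄ * y₂₃) (- (y₁₄ * y₂₃ * y₃₂))
    dependency⇒T₂ a≉0 {y₁₄} {y₂₄} {y₃₄} N = Null-swap₂₃ (Null-swap₁₂ (Null-cancel a≉0 (Null-resp
      (begin
        - (y₂₃ * y₃₂ * (a * y₁₄))      ≈⟨ -‿cong (solve 4 (λ a x y z → (y ⊕ z) ⊕ (a ⊕ x) ⊜ a ⊕ ((x ⊕ y) ⊕ z)) ≈-refl a y₁₄ y₂₃ y₃₂) ⟩
        - (a * (y₁₄ * y₂₃ * y₃₂))      ≈⟨ *-‿distribʳ _ _ ⟩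
        a * - (y₁₄ * y₂₃ * y₃₂)        ∎)
      (begin
        - (y₂₃ * y₃₂ * (b * y₂₄))      ≈⟨ -‿cong (solve 4 (λ b x y z → (y ⊕ z) ⊕ (b ⊕ x) ⊜ (b ⊕ y) ⊕ (x ⊕ z)) ≈-refl b y₂₄ y₂₃ y₃₂) ⟩
        - (b * y₂₃ * (y₂₄ * y₃₂))      ≈⟨ -‿distribˡ-* _ _ ⟨
        - (b * y₂₃) * (y₂₄ * y₃₂)      ≈⟨ ∙-congʳ (Null⇒≈- N₃) ⟨
        a * y₁₃ * (y₂₄ * y₃₂)          ≈⟨ solve 4 (λ a x y z → (a ⊕ x) ⊕ (y ⊕ z) ⊜ a ⊕ ((x ⊕ y) ⊕ z)) ≈-refl a y₁₃ y₂₄ y₃₂ ⟩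
        a * (y₁₃ * y₂₄ * y₃₂)          ∎)
      (begin
        - (y₂₃ * y₃₂ * (c * y₃₄))      ≈⟨ -‿cong (solve 4 (λ c x y z → (y ⊕ z) ⊕ (c ⊕ x) ⊜ (c ⊕ z) ⊕ (x ⊕ y)) ≈-refl c y₃₄ y₂₃ y₃₂) ⟩
        - (c * y₃₂ * (y₃₄ * y₂₃))      ≈⟨ -‿distribˡ-* _ _ ⟨
        - (c * y₃₂) * (y₃₄ * y₂₃)      ≈⟨ ∙-congʳ (Null⇒≈- (Null-swap₁₂ N₂)) ⟨
        a * y₁₂ * (y₃₄ * y₂₃)          ≈⟨ solve 4 (λ a x y z → (a ⊕ x) ⊕ (y ⊕ z) ⊜ a ⊕ ((x ⊕ y) ⊕ z)) ≈-refl a y₁₂ y₃₄ y₂₃ ⟩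
        a * (y₁₂ * y₃₄ * y₂₃)          ∎)
      (Null-neg (Null-* (y₂₃ * y₃₂) N)))))

    module _ (y₁₂≉0 : y₁₂ ≉ 0#) (y₁₃≉0 : y₁₃ ≉ 0#) (y₂₁≉0 : y₂₁ ≉ 0#)
             (y₂₃≉0 : y₂₃ ≉ 0#) (y₃₁≉0 : y₃₁ ≉ 0#) (y₃₂≉0 : y₃₂ ≉ 0#)
             (abc≉0 : ¬ (a ≈ 0# × b ≈ 0# × c ≈ 0#)) where

      private
        coefficient-zero : ∀ {a b y z} → Null (a * y) (b * z) 0# → z ≉ 0# → a ≈ 0# → b ≈ 0#
        coefficient-zero {a} {b} {y} {z} N z≉0 a≈0 = *-cancelˡ z≉0 (begin
          z * b     ≈⟨ comm z b ⟩
          b * z     ≈⟨ Null-zero N (≈-trans (∙-congʳ a≈0) (zeroˡ y)) ⟩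
          0#        ≈⟨ zeroʳ z ⟨
          z * 0#    ∎)

      -- Each binary relation links two coefficients through nonzero values, so if one coefficient
      -- vanished, all would.
      dependency-a≉0 : a ≉ 0#
      dependency-a≉0 a≈0 = abc≉0
        (a≈0 , coefficient-zero (Null-swap₁₂ N₃) y₂₃≉0 a≈0 , coefficient-zero N₂ y₃₂≉0 a≈0)

      dependency-b≉0 : b ≉ 0#
      dependency-b≉0 b≈0 = abc≉0
        (coefficient-zero N₃ y₁₃≉0 b≈0 , b≈0 , coefficient-zero (Null-swap₁₂ N₁) y₃₁≉0 b≈0)

      dependency-c≉0 : c ≉ 0#
      dependency-c≉0 c≈0 = abc≉0
        (coefficient-zero (Null-swap₁₂ N₂) y₁₂≉0 c≈0 , coefficient-zero N₁ y₂₁≉0 c≈0 , c≈0)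

  -- The coefficients are solved from the dependency at a₂ and a₃, up to a common
  -- factor that avoids inverses; zᵢ stands for φ_{Hᵢ}(e).
  module _ {y₁₂ y₁₃ y₂₃ y₃₂ z₁ z₂ z₃ : Carrier} where

    Dependent : Set ν
    Dependent = Null (y₂₃ * y₃₂ * z₁) (- (y₁₃ * y₃₂) * z₂) (- (y₁₂ * y₂₃) * z₃)

    dependent-H₁ : z₁ ≈ 0# → Null (y₁₂ * y₂₃ * z₃) (y₁₃ * z₂ * y₃₂) 0# → Dependent
    dependent-H₁ z₁≈0 N = Null-swap₁₂ (Null-swap₂₃ (Null-swap₁₂ (Null-resp
      (≈-sym (-‿distribˡ-* _ _))
      (≈-trans (-‿cong (solve 3 (λ x y z → (x ⊕ y) ⊕ z ⊜ (x ⊕ z) ⊕ y) ≈-refl y₁₃ z₂ y₃₂)) (≈-sym (-‿distribˡ-* _ _)))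
      (begin
        - 0#                ≈⟨ -‿unique Null-0 ⟩
        0#                  ≈⟨ zeroʳ _ ⟨
        y₂₃ * y₃₂ * 0#      ≈⟨ ∙-congˡ z₁≈0 ⟨
        y₂₃ * y₃₂ * z₁      ∎)
      (Null-neg N))))

    dependent-generic : Null (y₁₃ * z₂ * y₃₂) (y₁₂ * z₃ * y₂₃) (- (z₁ * y₂₃ * y₃₂)) → Dependent
    dependent-generic N = Null-swap₁₂ (Null-swap₂₃ (Null-resp
      (≈-trans (-‿cong (solve 3 (λ x y z → (x ⊕ y) ⊕ z ⊜ (x ⊕ z) ⊕ y) ≈-refl y₁₃ z₂ y₃₂)) (≈-sym (-‿distribˡ-* _ _)))
      (≈-trans (-‿cong (solve 3 (λ x y z → (x ⊕ y) ⊕ z ⊜ (x ⊕ z) ⊕ y) ≈-refl y₁₂ z₃ y₂₃)) (≈-sym (-‿distribˡ-* _ _)))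
      (≈-trans (-‿involutive _) (solve 3 (λ x y z → (x ⊕ y) ⊕ z ⊜ (y ⊕ z) ⊕ x) ≈-refl z₁ y₂₃ y₃₂))
      (Null-neg N)))

    module _ {y₂₁ y₃₁ : Carrier} (N₀ : Null (y₁₂ * y₂₃ * y₃₁) (y₁₃ * y₂₁ * y₃₂) 0#)
             (y₁₂≉0 : y₁₂ ≉ 0#) (y₁₃≉0 : y₁₃ ≉ 0#) (y₂₁≉0 : y₂₁ ≉ 0#) (y₃₁≉0 : y₃₁ ≉ 0#) where

      -- Here `e` takes the place of a₂. The coefficients do not involve a₁, so `N` is compared with
      -- `N₀`, which is (T1) at the chosen points, in order to eliminate y₂₁ and y₃₁; `dependent-H₃`
      -- is analogous.
      dependent-H₂ : z₂ ≈ 0# → Null (z₁ * y₂₃ * y₃₁) (y₁₃ * y₂₁ * z₃) 0# → Dependent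
      dependent-H₂ z₂≈0 N = Null-swap₂₃ (Null-resp ≈-refl
        (begin
          - (y₂₃ * y₃₂ * z₁)        ≈⟨ -‿cong equal ⟩
          - (y₁₂ * y₂₃ * z₃)        ≈⟨ -‿distribˡ-* _ _ ⟨
          - (y₁₂ * y₂₃) * z₃        ∎)
        (≈-sym (≈-trans (∙-congˡ z₂≈0) (zeroʳ _)))
        (-‿null _))
        where
        equal : y₂₃ * y₃₂ * z₁ ≈ y₁₂ * y₂₃ * z₃
        equal = *-cancelˡ (*-nonzero (*-nonzero y₁₃≉0 y₂₁≉0) y₃₁≉0) (begin
          y₁₃ * y₂₁ * y₃₁ * (y₂₃ * y₃₂ * z₁)
            ≈⟨ solve 6 (λ a b c x y z → ((a ⊕ b) ⊕ c) ⊕ ((x ⊕ y) ⊕ z) ⊜ ((z ⊕ x) ⊕ c) ⊕ ((a ⊕ b) ⊕ y)) ≈-refl y₁₃ y₂₁ y₃₁ y₂₃ y₃₂ z₁ ⟩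
          z₁ * y₂₃ * y₃₁ * (y₁₃ * y₂₁ * y₃₂)
            ≈⟨ Null-cross N N₀ ⟩
          y₁₂ * y₂₃ * y₃₁ * (y₁₃ * y₂₁ * z₃)
            ≈⟨ solve 6 (λ a b c x y z → ((x ⊕ y) ⊕ c) ⊕ ((a ⊕ b) ⊕ z) ⊜ ((a ⊕ b) ⊕ c) ⊕ ((x ⊕ y) ⊕ z)) ≈-refl y₁₃ y₂₁ y₃₁ y₁₂ y₂₃ z₃ ⟩
          y₁₃ * y₂₁ * y₃₁ * (y₁₂ * y₂₃ * z₃) ∎)

      dependent-H₃ : z₃ ≈ 0# → Null (y₁₂ * z₂ * y₃₁) (z₁ * y₂₁ * y₃₂) 0# → Dependent
      dependent-H₃ z₃≈0 N = Null-resp ≈-refl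
        (begin
          - (y₂₃ * y₃₂ * z₁)        ≈⟨ -‿cong equal ⟩
          - (y₁₃ * y₃₂ * z₂)        ≈⟨ -‿distribˡ-* _ _ ⟨
          - (y₁₃ * y₃₂) * z₂        ∎)
        (≈-sym (≈-trans (∙-congˡ z₃≈0) (zeroʳ _)))
        (-‿null _)
        where
        equal : y₂₃ * y₃₂ * z₁ ≈ y₁₃ * y₃₂ * z₂
        equal = *-cancelˡ (*-nonzero (*-nonzero y₁₂≉0 y₂₁≉0) y₃₁≉0) (begin
          y₁₂ * y₂₁ * y₃₁ * (y₂₃ * y₃₂ * z₁)
            ≈⟨ solve 6 (λ a b c x y z → ((a ⊕ b) ⊕ c) ⊕ ((x ⊕ y) ⊕ z) ⊜ ((a ⊕ x) ⊕ c) ⊕ ((z ⊕ b) ⊕ y)) ≈-refl y₁₂ y₂₁ y₃₁ y₂₃ y₃₂ z₁ ⟩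
          y₁₂ * y₂₃ * y₃₁ * (z₁ * y₂₁ * y₃₂)
            ≈⟨ Null-cross N₀ N ⟩
          y₁₂ * z₂ * y₃₁ * (y₁₃ * y₂₁ * y₃₂)
            ≈⟨ solve 6 (λ a b c x y z → ((a ⊕ z) ⊕ c) ⊕ ((x ⊕ b) ⊕ y) ⊜ ((a ⊕ b) ⊕ c) ⊕ ((x ⊕ y) ⊕ z)) ≈-refl y₁₂ y₂₁ y₃₁ y₁₃ y₃₂ z₂ ⟩
          y₁₂ * y₂₁ * y₃₁ * (y₁₃ * y₃₂ * z₂) ∎)

-- Representations and the relations T

pattern 1st = here refl
pattern 2nd = there (here refl)
pattern 3rd = there (there (here refl))
pattern 4th = there (there (there (here refl)))

module _ {M : Matroid n} where

  ⋂-⊆ : ∀ {H : Hyperplane M} {Hs} → H ∈ˡ Hs → ⋂ (map set Hs) ⊆ set H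
  ⋂-⊆ {Hs = Hs} H∈Hs x∈⋂ = All.lookup (x∈⋂⁻ (map set Hs) x∈⋂) (∈-map⁺ set H∈Hs)

  -- Distinct members meet only in L. Hence every pair that occurs in (T1) and (T2) is an edge of
  -- the incidence graph.
  modular-∉ : ∀ {Hs} → IsModular M Hs → ∀ {H H′} → H ∈ˡ Hs → H′ ∈ˡ Hs → H ≢ H′ →
              ∀ {a} → a ∈ set H ─ ⋂ (map set Hs) → a ∉ set H′
  modular-∉ {Hs} modular H∈ H′∈ H≢H′ a∈H─L a∈H′ = x∈p─q⇒x∉q _ _ a∈H─L
    (hyperplanes-∩ modular H≢H′ (⋂-⊆ H∈) (⋂-⊆ H′∈) (Subset.p─q⊆p _ _ a∈H─L) a∈H′)

  -- Two distinct hyperplanes over L already meet in L. This lets (T2) for a quadruple follow from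
  -- the dependency of its first three members.
  modular-triple : ∀ {H₁ H₂ H₃ H₄ : Hyperplane M} → H₁ ≢ H₂ → IsModular M (H₁ ∷ H₂ ∷ H₃ ∷ H₄ ∷ []) →
    ⋂ (map set (H₁ ∷ H₂ ∷ H₃ ∷ H₄ ∷ [])) ≡ ⋂ (map set (H₁ ∷ H₂ ∷ H₃ ∷ []))
  modular-triple {H₁} {H₂} {H₃} {H₄} H₁≢H₂ modular = Subset.⊆-antisym
    (λ x∈L → x∈⋂⁺ (⋂-⊆ {Hs = Hs} 1st x∈L ∷ ⋂-⊆ {Hs = Hs} 2nd x∈L ∷ ⋂-⊆ {Hs = Hs} 3rd x∈L ∷ []))
    (λ x∈L → hyperplanes-∩ modular H₁≢H₂ (⋂-⊆ {Hs = Hs} 1st) (⋂-⊆ {Hs = Hs} 2nd)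
      (⋂-⊆ {Hs = Hs′} 1st x∈L) (⋂-⊆ {Hs = Hs′} 2nd x∈L))
    where
    Hs Hs′ : List (Hyperplane M)
    Hs = H₁ ∷ H₂ ∷ H₃ ∷ H₄ ∷ []
    Hs′ = H₁ ∷ H₂ ∷ H₃ ∷ []

module _ {M : Matroid n} (P : Pasture c ℓ ν) where
  open Pasture P
  open PastureProperties P

  -- (T1) and (T2) with denominators cleared.
  record SatisfiesT (φ : Hyperplane M → Fin n → Carrier) : Set ν where
    field
      T₁-cleared : ∀ H₁ H₂ H₃ → Unique (H₁ ∷ H₂ ∷ H₃ ∷ []) → IsModular M (H₁ ∷ H₂ ∷ H₃ ∷ []) →
        let L = ⋂ (map set (H₁ ∷ H₂ ∷ H₃ ∷ [])) in
        ∀ {a₁ a₂ a₃} → a₁ ∈ set H₁ ─ L → a₂ ∈ set H₂ ─ L → a₃ ∈ set H₃ ─ L →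
        Null (φ H₁ a₂ * φ H₂ a₃ * φ H₃ a₁) (φ H₁ a₃ * φ H₂ a₁ * φ H₃ a₂) 0#
      T₂-cleared : ∀ H₁ H₂ H₃ H₄ → Unique (H₁ ∷ H₂ ∷ H₃ ∷ H₄ ∷ []) → IsModular M (H₁ ∷ H₂ ∷ H₃ ∷ H₄ ∷ []) →
        let L = ⋂ (map set (H₁ ∷ H₂ ∷ H₃ ∷ H₄ ∷ [])) in
        ∀ {a₁ a₂ a₃ a₄} → a₁ ∈ set H₁ ─ L → a₂ ∈ set H₂ ─ L → a₃ ∈ set H₃ ─ L → a₄ ∈ set H₄ ─ L →
        Null (φ H₁ a₃ * φ H₂ a₄ * φ H₃ a₂) (φ H₁ a₂ * φ H₃ a₄ * φ H₂ a₃) (- (φ H₁ a₄ * φ H₂ a₃ * φ H₃ a₂))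

  open SatisfiesT

  -- The relations involve only values at edges of the incidence graph, by `modular-∉`.
  satisfiesT-resp : {φ φ′ : Hyperplane M → Fin n → Carrier} → (∀ {H e} → e ∉ set H → φ H e ≈ φ′ H e) →
                    SatisfiesT φ → SatisfiesT φ′
  satisfiesT-resp {φ} {φ′} φ≈φ′ sat .T₁-cleared H₁ H₂ H₃
    H!@((H₁≢H₂ ∷ H₁≢H₃ ∷ []) ∷ (H₂≢H₃ ∷ []) ∷ [] ∷ []) modular {a₁} {a₂} {a₃} a₁∈ a₂∈ a₃∈ = Null-resp
      (∙-cong (∙-cong y₁₂ y₂₃) y₃₁) (∙-cong (∙-cong y₁₃ y₂₁) y₃₂) ≈-refl
      (T₁-cleared sat H₁ H₂ H₃ H! modular a₁∈ a₂∈ a₃∈)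
    where
    off = modular-∉ {Hs = H₁ ∷ H₂ ∷ H₃ ∷ []} modular
    y₁₂ : φ H₁ a₂ ≈ φ′ H₁ a₂
    y₁₂ = φ≈φ′ (off 2nd 1st (H₁≢H₂ ∘ ≡.sym) a₂∈)
    y₁₃ : φ H₁ a₃ ≈ φ′ H₁ a₃
    y₁₃ = φ≈φ′ (off 3rd 1st (H₁≢H₃ ∘ ≡.sym) a₃∈)
    y₂₁ : φ H₂ a₁ ≈ φ′ H₂ a₁
    y₂₁ = φ≈φ′ (off 1st 2nd H₁≢H₂ a₁∈)
    y₂₃ : φ H₂ a₃ ≈ φ′ H₂ a₃
    y₂₃ = φ≈φ′ (off 3rd 2nd (H₂≢H₃ ∘ ≡.sym) a₃∈)
    y₃₁ : φ H₃ a₁ ≈ φ′ H₃ a₁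
    y₃₁ = φ≈φ′ (off 1st 3rd H₁≢H₃ a₁∈)
    y₃₂ : φ H₃ a₂ ≈ φ′ H₃ a₂
    y₃₂ = φ≈φ′ (off 2nd 3rd H₂≢H₃ a₂∈)
  satisfiesT-resp {φ} {φ′} φ≈φ′ sat .T₂-cleared H₁ H₂ H₃ H₄
    H!@((H₁≢H₂ ∷ H₁≢H₃ ∷ H₁≢H₄ ∷ []) ∷ (H₂≢H₃ ∷ H₂≢H₄ ∷ []) ∷ (H₃≢H₄ ∷ []) ∷ [] ∷ []) modular
    {a₁} {a₂} {a₃} {a₄} a₁∈ a₂∈ a₃∈ a₄∈ = Null-resp
      (∙-cong (∙-cong y₁₃ y₂₄) y₃₂) (∙-cong (∙-cong y₁₂ y₃₄) y₂₃) (-‿cong (∙-cong (∙-cong y₁₄ y₂₃) y₃₂))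
      (T₂-cleared sat H₁ H₂ H₃ H₄ H! modular a₁∈ a₂∈ a₃∈ a₄∈)
    where
    off = modular-∉ {Hs = H₁ ∷ H₂ ∷ H₃ ∷ H₄ ∷ []} modular
    y₁₂ : φ H₁ a₂ ≈ φ′ H₁ a₂
    y₁₂ = φ≈φ′ (off 2nd 1st (H₁≢H₂ ∘ ≡.sym) a₂∈)
    y₁₃ : φ H₁ a₃ ≈ φ′ H₁ a₃
    y₁₃ = φ≈φ′ (off 3rd 1st (H₁≢H₃ ∘ ≡.sym) a₃∈)
    y₁₄ : φ H₁ a₄ ≈ φ′ H₁ a₄
    y₁₄ = φ≈φ′ (off 4th 1st (H₁≢H₄ ∘ ≡.sym) a₄∈)
    y₂₃ : φ H₂ a₃ ≈ φ′ H₂ a₃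
    y₂₃ = φ≈φ′ (off 3rd 2nd (H₂≢H₃ ∘ ≡.sym) a₃∈)
    y₂₄ : φ H₂ a₄ ≈ φ′ H₂ a₄
    y₂₄ = φ≈φ′ (off 4th 2nd (H₂≢H₄ ∘ ≡.sym) a₄∈)
    y₃₂ : φ H₃ a₂ ≈ φ′ H₃ a₂
    y₃₂ = φ≈φ′ (off 2nd 3rd H₂≢H₃ a₂∈)
    y₃₄ : φ H₃ a₄ ≈ φ′ H₃ a₄
    y₃₄ = φ≈φ′ (off 4th 3rd (H₃≢H₄ ∘ ≡.sym) a₄∈)

  module _ (R : Representation M P) where
    open Representation R

    φ≈0 : ∀ {H e} → e ∈ set H → φ H e ≈ 0#
    φ≈0 = Equivalence.from (φ-zero _ _)

    φ≉0 : ∀ {H e} → e ∉ set H → φ H e ≉ 0#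
    φ≉0 e∉H = e∉H ∘ Equivalence.to (φ-zero _ _)

    module _ {H₁ H₂ H₃ : Hyperplane M} (H! : Unique (H₁ ∷ H₂ ∷ H₃ ∷ []))
             (modular : IsModular M (H₁ ∷ H₂ ∷ H₃ ∷ [])) where
      private
        Hs : List (Hyperplane M)
        Hs = H₁ ∷ H₂ ∷ H₃ ∷ []
        H₁≢H₂ : H₁ ≢ H₂
        H₁≢H₂ = All.head (AllPairs.head H!)
        H₁≢H₃ : H₁ ≢ H₃
        H₁≢H₃ = All.head (All.tail (AllPairs.head H!))
        H₂≢H₃ : H₂ ≢ H₃
        H₂≢H₃ = All.head (AllPairs.head (AllPairs.tail H!))
        off = modular-∉ {Hs = Hs} modular

      module Dependency {a₁ a₂ a₃} (a₁∈ : a₁ ∈ set H₁ ─ ⋂ (map set Hs))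
               (a₂∈ : a₂ ∈ set H₂ ─ ⋂ (map set Hs)) (a₃∈ : a₃ ∈ set H₃ ─ ⋂ (map set Hs)) where
        private
          a b d : Carrier
          a = proj₁ (φ-modular H₁ H₂ H₃ H! modular)
          b = proj₁ (proj₂ (φ-modular H₁ H₂ H₃ H! modular))
          d = proj₁ (proj₂ (proj₂ (φ-modular H₁ H₂ H₃ H! modular)))
          abd≉0 : ¬ (a ≈ 0# × b ≈ 0# × d ≈ 0#)
          abd≉0 = proj₁ (proj₂ (proj₂ (proj₂ (φ-modular H₁ H₂ H₃ H! modular))))
          N : ∀ e → Null (a * φ H₁ e) (b * φ H₂ e) (d * φ H₃ e)
          N = proj₂ (proj₂ (proj₂ (proj₂ (φ-modular H₁ H₂ H₃ H! modular))))
          ─⇒≈0 : ∀ u {H e} → e ∈ set H ─ ⋂ (map set Hs) → u * φ H e ≈ 0#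
          ─⇒≈0 u e∈ = ≈-trans (∙-congˡ (φ≈0 (Subset.p─q⊆p _ _ e∈))) (zeroʳ u)
          -- At aᵢ the term of Hᵢ vanishes, which leaves a binary relation between the other two
          -- terms.
          N₁ : Null (d * φ H₃ a₁) (b * φ H₂ a₁) 0#
          N₁ = Null-swap₁₂ (Null-swap₂₃ (Null-swap₁₂ (Null-resp (─⇒≈0 a a₁∈) ≈-refl ≈-refl (N a₁))))
          N₂ : Null (a * φ H₁ a₂) (d * φ H₃ a₂) 0#
          N₂ = Null-swap₂₃ (Null-resp ≈-refl (─⇒≈0 b a₂∈) ≈-refl (N a₂))
          N₃ : Null (b * φ H₂ a₃) (a * φ H₁ a₃) 0#
          N₃ = Null-swap₁₂ (Null-resp ≈-refl ≈-refl (─⇒≈0 d a₃∈) (N a₃))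
          y₁₂ : φ H₁ a₂ ≉ 0#
          y₁₂ = φ≉0 (off 2nd 1st (H₁≢H₂ ∘ ≡.sym) a₂∈)
          y₁₃ : φ H₁ a₃ ≉ 0#
          y₁₃ = φ≉0 (off 3rd 1st (H₁≢H₃ ∘ ≡.sym) a₃∈)
          y₂₁ : φ H₂ a₁ ≉ 0#
          y₂₁ = φ≉0 (off 1st 2nd H₁≢H₂ a₁∈)
          y₂₃ : φ H₂ a₃ ≉ 0#
          y₂₃ = φ≉0 (off 3rd 2nd (H₂≢H₃ ∘ ≡.sym) a₃∈)
          y₃₁ : φ H₃ a₁ ≉ 0#
          y₃₁ = φ≉0 (off 1st 3rd H₁≢H₃ a₁∈)
          y₃₂ : φ H₃ a₂ ≉ 0#
          y₃₂ = φ≉0 (off 2nd 3rd H₂≢H₃ a₂∈)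

        T₁-holds : Null (φ H₁ a₂ * φ H₂ a₃ * φ H₃ a₁) (φ H₁ a₃ * φ H₂ a₁ * φ H₃ a₂) 0#
        T₁-holds = dependency⇒T₁ N₁ N₂ N₃
          (dependency-a≉0 N₁ N₂ N₃ y₁₂ y₁₃ y₂₁ y₂₃ y₃₁ y₃₂ abd≉0)
          (dependency-b≉0 N₁ N₂ N₃ y₁₂ y₁₃ y₂₁ y₂₃ y₃₁ y₃₂ abd≉0)
          (dependency-c≉0 N₁ N₂ N₃ y₁₂ y₁₃ y₂₁ y₂₃ y₃₁ y₃₂ abd≉0)

        T₂-holds : ∀ e → Null (φ H₁ a₃ * φ H₂ e * φ H₃ a₂) (φ H₁ a₂ * φ H₃ e * φ H₂ a₃) (- (φ H₁ e * φ H₂ a₃ * φ H₃ a₂))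
        T₂-holds e = dependency⇒T₂ N₁ N₂ N₃
          (dependency-a≉0 N₁ N₂ N₃ y₁₂ y₁₃ y₂₁ y₂₃ y₃₁ y₃₂ abd≉0) (N e)

    representation⇒T : SatisfiesT φ
    representation⇒T .T₁-cleared H₁ H₂ H₃ H! modular a₁∈ a₂∈ a₃∈ = Dependency.T₁-holds H! modular a₁∈ a₂∈ a₃∈
    representation⇒T .T₂-cleared H₁ H₂ H₃ H₄
      ((H₁≢H₂ ∷ H₁≢H₃ ∷ _) ∷ (H₂≢H₃ ∷ _) ∷ _) modular {a₄ = a₄} a₁∈ a₂∈ a₃∈ _ = Dependency.T₂-holds
        ((H₁≢H₂ ∷ H₁≢H₃ ∷ []) ∷ (H₂≢H₃ ∷ []) ∷ [] ∷ [])
        (subst (IsFlatOfCorank M 2) L≡ modular)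
        (subst (λ L → _ ∈ set H₁ ─ L) L≡ a₁∈) (subst (λ L → _ ∈ set H₂ ─ L) L≡ a₂∈)
        (subst (λ L → _ ∈ set H₃ ─ L) L≡ a₃∈) a₄
      where
      L≡ = modular-triple {H₁ = H₁} {H₂} {H₃} {H₄} H₁≢H₂ modular

  module _ {φ : Hyperplane M → Fin n → Carrier} (φ-zero : ∀ H e → φ H e ≈ 0# ⇔ e ∈ set H) (sat : SatisfiesT φ) where

    private
      φ≈0′ : ∀ {H e} → e ∈ set H → φ H e ≈ 0#
      φ≈0′ = Equivalence.from (φ-zero _ _)
      φ≉0′ : ∀ {H e} → e ∉ set H → φ H e ≉ 0#
      φ≉0′ e∉H = e∉H ∘ Equivalence.to (φ-zero _ _)

    T⇒modular : ∀ H₁ H₂ H₃ → Unique (H₁ ∷ H₂ ∷ H₃ ∷ []) → IsModular M (H₁ ∷ H₂ ∷ H₃ ∷ []) →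
                ∃[ a ] ∃[ b ] ∃[ d ] ¬ (a ≈ 0# × b ≈ 0# × d ≈ 0#) ×
                (∀ e → Null (a * φ H₁ e) (b * φ H₂ e) (d * φ H₃ e))
    T⇒modular H₁ H₂ H₃ H!@((H₁≢H₂ ∷ H₁≢H₃ ∷ []) ∷ (H₂≢H₃ ∷ []) ∷ [] ∷ []) modular
      with hyperplane∖corank2 modular H₁ | hyperplane∖corank2 modular H₂ | hyperplane∖corank2 modular H₃
    ... | a₁ , a₁∈H₁ , a₁∉L | a₂ , a₂∈H₂ , a₂∉L | a₃ , a₃∈H₃ , a₃∉L =
        φ H₂ a₃ * φ H₃ a₂ , - (φ H₁ a₃ * φ H₃ a₂) , - (φ H₁ a₂ * φ H₂ a₃)
        , (λ (a≈0 , _) → *-nonzero y₂₃ y₃₂ a≈0) , dependent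
      where
      L : Subset _
      L = ⋂ (map set (H₁ ∷ H₂ ∷ H₃ ∷ []))
      a₁∈ : a₁ ∈ set H₁ ─ L
      a₁∈ = Subset.x∈p∧x∉q⇒x∈p─q a₁∈H₁ a₁∉L
      a₂∈ : a₂ ∈ set H₂ ─ L
      a₂∈ = Subset.x∈p∧x∉q⇒x∈p─q a₂∈H₂ a₂∉L
      a₃∈ : a₃ ∈ set H₃ ─ L
      a₃∈ = Subset.x∈p∧x∉q⇒x∈p─q a₃∈H₃ a₃∉L
      off = modular-∉ {Hs = H₁ ∷ H₂ ∷ H₃ ∷ []} modular
      y₁₂ : φ H₁ a₂ ≉ 0#
      y₁₂ = φ≉0′ (off 2nd 1st (H₁≢H₂ ∘ ≡.sym) a₂∈)
      y₁₃ : φ H₁ a₃ ≉ 0#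
      y₁₃ = φ≉0′ (off 3rd 1st (H₁≢H₃ ∘ ≡.sym) a₃∈)
      y₂₁ : φ H₂ a₁ ≉ 0#
      y₂₁ = φ≉0′ (off 1st 2nd H₁≢H₂ a₁∈)
      y₂₃ : φ H₂ a₃ ≉ 0#
      y₂₃ = φ≉0′ (off 3rd 2nd (H₂≢H₃ ∘ ≡.sym) a₃∈)
      y₃₁ : φ H₃ a₁ ≉ 0#
      y₃₁ = φ≉0′ (off 1st 3rd H₁≢H₃ a₁∈)
      y₃₂ : φ H₃ a₂ ≉ 0#
      y₃₂ = φ≉0′ (off 2nd 3rd H₂≢H₃ a₂∈)
      N : ∀ {a₁ a₂ a₃} → a₁ ∈ set H₁ ─ L → a₂ ∈ set H₂ ─ L → a₃ ∈ set H₃ ─ L →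
          Null (φ H₁ a₂ * φ H₂ a₃ * φ H₃ a₁) (φ H₁ a₃ * φ H₂ a₁ * φ H₃ a₂) 0#
      N = T₁-cleared sat H₁ H₂ H₃ H! modular
      dependent : ∀ e → Null (φ H₂ a₃ * φ H₃ a₂ * φ H₁ e) (- (φ H₁ a₃ * φ H₃ a₂) * φ H₂ e) (- (φ H₁ a₂ * φ H₂ a₃) * φ H₃ e)
      dependent e with e Subset.∈? L | e Subset.∈? set H₁ | e Subset.∈? set H₂ | e Subset.∈? set H₃
      ... | yes e∈L | _ | _ | _ = Null-resp (vanish _ 1st) (vanish _ 2nd) (vanish _ 3rd) Null-0
        where
        vanish : ∀ u {H} → H ∈ˡ (H₁ ∷ H₂ ∷ H₃ ∷ []) → 0# ≈ u * φ H e
        vanish u H∈ = ≈-sym (≈-trans (∙-congˡ (φ≈0′ (⋂-⊆ {Hs = H₁ ∷ H₂ ∷ H₃ ∷ []} H∈ e∈L))) (zeroʳ u))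
      ... | no e∉L | yes e∈H₁ | _ | _ = dependent-H₁ (φ≈0′ e∈H₁) (N (Subset.x∈p∧x∉q⇒x∈p─q e∈H₁ e∉L) a₂∈ a₃∈)
      ... | no e∉L | _ | yes e∈H₂ | _ = dependent-H₂ (N a₁∈ a₂∈ a₃∈) y₁₂ y₁₃ y₂₁ y₃₁
        (φ≈0′ e∈H₂) (N a₁∈ (Subset.x∈p∧x∉q⇒x∈p─q e∈H₂ e∉L) a₃∈)
      ... | no e∉L | _ | _ | yes e∈H₃ = dependent-H₃ (N a₁∈ a₂∈ a₃∈) y₁₂ y₁₃ y₂₁ y₃₁
        (φ≈0′ e∈H₃) (N a₁∈ a₂∈ (Subset.x∈p∧x∉q⇒x∈p─q e∈H₃ e∉L))
      -- The hyperplane through L and `e` differs from the other three because it contains `e`, and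
      -- joining it to them keeps the intersection L.
      ... | no e∉L | no e∉H₁ | no e∉H₂ | no e∉H₃ with hyperplane-through modular e∉L
      ...   | H₄ , L⊆H₄ , e∈H₄ = dependent-generic (T₂-cleared sat H₁ H₂ H₃ H₄
          ((H₁≢H₂ ∷ H₁≢H₃ ∷ ≢H₄ e∉H₁ ∷ []) ∷ (H₂≢H₃ ∷ ≢H₄ e∉H₂ ∷ []) ∷ (≢H₄ e∉H₃ ∷ []) ∷ [] ∷ [])
          (subst (IsFlatOfCorank M 2) L≡ modular)
          (subst (λ L → a₁ ∈ set H₁ ─ L) L≡ a₁∈) (subst (λ L → a₂ ∈ set H₂ ─ L) L≡ a₂∈) (subst (λ L → a₃ ∈ set H₃ ─ L) L≡ a₃∈)
          (subst (λ L → e ∈ set H₄ ─ L) L≡ (Subset.x∈p∧x∉q⇒x∈p─q e∈H₄ e∉L)))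
        where
        ≢H₄ : ∀ {H} → e ∉ set H → H ≢ H₄
        ≢H₄ e∉H refl = e∉H e∈H₄
        L≡ : L ≡ ⋂ (map set (H₁ ∷ H₂ ∷ H₃ ∷ H₄ ∷ []))
        L≡ = Subset.⊆-antisym
          (λ x∈L → x∈⋂⁺ (⋂-⊆ {Hs = Hs} 1st x∈L ∷ ⋂-⊆ {Hs = Hs} 2nd x∈L ∷ ⋂-⊆ {Hs = Hs} 3rd x∈L ∷ L⊆H₄ x∈L ∷ []))
          (λ x∈L → x∈⋂⁺ (⋂-⊆ {Hs = Hs′} 1st x∈L ∷ ⋂-⊆ {Hs = Hs′} 2nd x∈L ∷ ⋂-⊆ {Hs = Hs′} 3rd x∈L ∷ []))
          where
          Hs Hs′ : List (Hyperplane M)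
          Hs = H₁ ∷ H₂ ∷ H₃ ∷ []
          Hs′ = H₁ ∷ H₂ ∷ H₃ ∷ H₄ ∷ []

    T⇒representation : Representation M P
    T⇒representation = record { φ = φ ; φ-zero = φ-zero ; φ-modular = T⇒modular }

-- Solutions of the relations T

mapMaybe-unique : {A B : Set} (f : A → Maybe B) → (∀ {x y b} → f x ≡ just b → f y ≡ just b → x ≡ y) →
                  ∀ {xs} → Unique xs → Unique (mapMaybe f xs)
mapMaybe-unique f f-inj [] = []
mapMaybe-unique f f-inj {x ∷ xs} (x∉xs ∷ xs!) with f x in fx
... | nothing = mapMaybe-unique f f-inj xs!
... | just b  = All.mapMaybe⁺ (All.map⁺ (All.map b≢ x∉xs)) ∷ mapMaybe-unique f f-inj xs!
  where
  b≢ : ∀ {y} → x ≢ y → MaybeAll.All (b ≢_) (f y)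
  b≢ {y} x≢y with f y in fy
  ... | nothing = MaybeAll.nothing
  ... | just b′ = MaybeAll.just λ { refl → x≢y (f-inj fx fy) }

lookup-injective : {A : Set} {xs : List A} → Unique xs → ∀ i j → lookup xs i ≡ lookup xs j → i ≡ j
lookup-injective (_ ∷ _)       zero    zero    _ = refl
lookup-injective (x≢xs ∷ _)    zero    (suc j) p = contradiction p (All.lookup x≢xs (∈-lookup j))
lookup-injective (x≢xs ∷ _)    (suc i) zero    p = contradiction (≡.sym p) (All.lookup x≢xs (∈-lookup i))
lookup-injective (_ ∷ xs!)     (suc i) (suc j) p = cong suc (lookup-injective xs! i j p)

∈-subsets : (A : Subset n) → A ∈ˡ subsets n
∈-subsets [] = here refl
∈-subsets (inside ∷ A)  = ∈-++⁺ˡ (∈-map⁺ (inside ∷_) (∈-subsets A))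
∈-subsets (outside ∷ A) = ∈-++⁺ʳ (map (inside ∷_) (subsets _)) (∈-map⁺ (outside ∷_) (∈-subsets A))

subsets-unique : ∀ n → Unique (subsets n)
subsets-unique zero    = [] ∷ []
subsets-unique (suc n) = Unique.++⁺
  (Unique.map⁺ Vec.∷-injectiveʳ (subsets-unique n))
  (Unique.map⁺ Vec.∷-injectiveʳ (subsets-unique n))
  λ (A∈in , A∈out) → disjoint (∈-map⁻ _ A∈in) (∈-map⁻ _ A∈out)
  where
  disjoint : ∀ {A : Subset (suc n)} → ∃[ B ] B ∈ˡ subsets n × A ≡ inside ∷ B →
             ∃[ B ] B ∈ˡ subsets n × A ≡ outside ∷ B → ⊥
  disjoint (_ , _ , refl) (_ , _ , ())

module _ (M : Matroid n) where

  private
    hyperplane? : Subset n → Maybe (Hyperplane M)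
    hyperplane? A = Maybe.map (λ p → A , p) (dec⇒maybe (isFlatOfCorank? M 1 A))

    hyperplane?-set : ∀ {A H} → hyperplane? A ≡ just H → A ≡ set H
    hyperplane?-set {A} eq with isFlatOfCorank? M 1 A
    hyperplane?-set refl | yes _ = refl
    hyperplane?-set () | no _

    hyperplane?-complete : ∀ H → MaybeAny.Any (H ≡_) (hyperplane? (set H))
    hyperplane?-complete H with isFlatOfCorank? M 1 (set H)
    ... | yes _ = MaybeAny.just refl
    ... | no ¬p = contradiction (isHyperplane H) ¬p

  ∈-hyperplanes : ∀ H → H ∈ˡ hyperplanes M
  ∈-hyperplanes H = Any.mapMaybe⁺ hyperplane? (subsets n)
    (Any.map⁺ (Any.map (λ { refl → hyperplane?-complete H }) (∈-subsets (set H))))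

  hyperplanes-unique : Unique (hyperplanes M)
  hyperplanes-unique = mapMaybe-unique hyperplane?
    (λ p q → ≡.trans (hyperplane?-set p) (≡.sym (hyperplane?-set q))) (subsets-unique n)

÷-∙ : (u v : Monomial k) → (u ÷ v) ∙ v ≡ u
÷-∙ (s , d) (t , e) = cong₂ _,_
  (≡.trans (Sign.*-assoc s t t) (≡.trans (cong (s Sign.*_) (Sign.s*s≡+ t)) (Sign.*-identityʳ s)))
  (minus-plus d e)
  where
  minus-plus : ∀ {k} (d e : Vec ℤ k) → zipWith ℤ._+_ (zipWith ℤ._-_ d e) e ≡ d
  minus-plus []      []      = refl
  minus-plus (i ∷ d) (j ∷ e) = cong₂ _∷_
    (≡.trans (ℤ.+-assoc i (ℤ.- j) j) (≡.trans (cong (λ z → i ℤ.+ z) (ℤ.+-inverseˡ j)) (ℤ.+-identityʳ i))) (minus-plus d e)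

module _ {M : Matroid n} {F : EdgeSet M} (F? : Decidable F) where

  ∈-S⁺ : ∀ {H e} → e ∉ set H → ¬ (H , e) ∈ᴾ F → (H , e) ∈ˡ S M F?
  ∈-S⁺ {H} {e} e∉H He∉F = ∈-filter⁺ _ (∈-cartesianProduct⁺ (∈-hyperplanes M H) (∈-allFin e)) (e∉H , He∉F)

  ∈-S⁻ : ∀ {H e} → (H , e) ∈ˡ S M F? → e ∉ set H × ¬ (H , e) ∈ᴾ F
  ∈-S⁻ He∈S = proj₂ (∈-filter⁻ _ {xs = cartesianProduct (hyperplanes M) (allFin n)} He∈S)

  -- Makes `index` inverse to `lookup`, so that the value of `x` at the `i`-th edge is the `i`-th
  -- indeterminate.
  S-unique : Unique (S M F?)
  S-unique = Unique.filter⁺ _ (Unique.cartesianProduct⁺ (hyperplanes-unique M) (Unique.allFin⁺ n))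

  x-view : ∀ H e → (Σ[ i ∈ Fin (length (S M F?)) ] lookup (S M F?) i ≡ (H , e) × x M F? H e ≡ var i) ⊎
                   ((H , e) ∉ˡ S M F? × x M F? H e ≡ 1ᵐ)
  x-view H e with DecMembership._∈?_ (_≟ᴱ_ M F?) (H , e) (S M F?)
  ... | yes i  = inj₁ (index i , ≡.sym (Any.lookup-index i) , refl)
  ... | no He∉S = inj₂ (He∉S , refl)

  x-lookup : ∀ i → x M F? (proj₁ (lookup (S M F?) i)) (proj₂ (lookup (S M F?) i)) ≡ var i
  x-lookup i with x-view (proj₁ (lookup (S M F?) i)) (proj₂ (lookup (S M F?) i))
  ... | inj₁ (j , Sj≡Si , x≡) = ≡.trans x≡ (cong var (lookup-injective S-unique j i Sj≡Si))
  ... | inj₂ (Si∉S , _) = contradiction (∈-lookup i) Si∉S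

  x-forest : ∀ {H e} → (H , e) ∈ᴾ F → x M F? H e ≡ 1ᵐ
  x-forest {H} {e} He∈F with x-view H e
  ... | inj₁ (i , Si≡He , _) = contradiction He∈F (proj₂ (∈-S⁻ (subst (_∈ˡ S M F?) Si≡He (∈-lookup i))))
  ... | inj₂ (_ , x≡1) = x≡1

  edge-cases : ∀ {H e} → e ∉ set H → (Σ[ i ∈ Fin (length (S M F?)) ] lookup (S M F?) i ≡ (H , e)) ⊎ (H , e) ∈ᴾ F
  edge-cases {H} {e} e∉H with F? (H , e)
  ... | yes He∈F = inj₂ He∈F
  ... | no He∉F  = inj₁ (index (∈-S⁺ e∉H He∉F) , ≡.sym (Any.lookup-index (∈-S⁺ e∉H He∉F)))

  -- Evaluation of the relations

  module _ (P : Pasture c ℓ ν) (g : Fin (length (S M F?)) → Pasture.Unit P) where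
    open Pasture P
    open PastureProperties P
    open CommutativeMonoidSolver commutativeMonoid using (solve; _⊜_; _⊕_)
    open SetoidReasoning setoid
    private
      module Φg = Morphism (Φ P g)
      ev : Monomial (length (S M F?)) → Carrier
      ev u = Φg.⟦ ⌜ u ⌝ ⟧
      X : Hyperplane M → Fin n → Monomial (length (S M F?))
      X = x M F?

    -- The family given by `g` on the edges in S and by 1 at all other pairs, including those with
    -- `e ∈ set H`; zeros are put there by `value₀` below.
    value : Hyperplane M → Fin n → Carrier
    value H e = ev (X H e)

    private
      ev≉0 : ∀ u → ev u ≉ 0#
      ev≉0 (s , e) = proj₂ (signed P s (power unitGroup g e))

      ev-∙ : ∀ u v → ev (u ∙ v) ≈ ev u * ev v
      ev-∙ u v = Φg.*-homo ⌜ u ⌝ ⌜ v ⌝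

      ev-∙∙ : ∀ u v w → ev (u ∙ v ∙ w) ≈ ev u * ev v * ev w
      ev-∙∙ u v w = ≈-trans (ev-∙ (u ∙ v) w) (∙-congʳ (ev-∙ u v))

      ev-÷ : ∀ u v → ev v * ev (u ÷ v) ≈ ev u
      ev-÷ u v = begin
        ev v * ev (u ÷ v)    ≈⟨ comm _ _ ⟩
        ev (u ÷ v) * ev v    ≈⟨ ev-∙ (u ÷ v) v ⟨
        ev ((u ÷ v) ∙ v)     ≡⟨ cong ev (÷-∙ u v) ⟩
        ev u                 ∎

      ev-1 : ∀ u → u * ev 1ᵐ ≈ u
      ev-1 u = ≈-trans (∙-congˡ Φg.1-homo) (identityʳ u)

      T₁-value : ∀ H₁ H₂ H₃ a₁ a₂ a₃ →
        let u = ev (X H₁ a₃ ∙ X H₂ a₁ ∙ X H₃ a₂) in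
        u * ev ((X H₁ a₂ ∙ X H₂ a₃ ∙ X H₃ a₁) ÷ (X H₁ a₃ ∙ X H₂ a₁ ∙ X H₃ a₂)) ≈ value H₁ a₂ * value H₂ a₃ * value H₃ a₁ ×
        u * ev 1ᵐ ≈ value H₁ a₃ * value H₂ a₁ * value H₃ a₂
      T₁-value H₁ H₂ H₃ a₁ a₂ a₃ = ≈-trans (ev-÷ (X H₁ a₂ ∙ X H₂ a₃ ∙ X H₃ a₁) _) (ev-∙∙ (X H₁ a₂) (X H₂ a₃) (X H₃ a₁))
        , ≈-trans (ev-1 _) (ev-∙∙ (X H₁ a₃) (X H₂ a₁) (X H₃ a₂))

      -- The factor `u` is a common denominator of the two fractions in (T2).
      T₂-value : ∀ H₁ H₂ H₃ a₂ a₃ a₄ →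
        let u = ev (X H₁ a₄ ∙ X H₂ a₃ ∙ X H₃ a₂) in
        u * ev ((X H₁ a₃ ∙ X H₂ a₄) ÷ (X H₁ a₄ ∙ X H₂ a₃)) ≈ value H₁ a₃ * value H₂ a₄ * value H₃ a₂ ×
        u * ev ((X H₁ a₂ ∙ X H₃ a₄) ÷ (X H₁ a₄ ∙ X H₃ a₂)) ≈ value H₁ a₂ * value H₃ a₄ * value H₂ a₃ ×
        u * Φg.⟦ negᶠ 1ᶠ ⟧ ≈ - (value H₁ a₄ * value H₂ a₃ * value H₃ a₂)
      T₂-value H₁ H₂ H₃ a₂ a₃ a₄ =
        (begin
          ev (X₁₄ ∙ X₂₃ ∙ X₃₂) * q                 ≈⟨ ∙-congʳ (ev-∙ (X₁₄ ∙ X₂₃) X₃₂) ⟩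
          ev (X₁₄ ∙ X₂₃) * ev X₃₂ * q              ≈⟨ solve 3 (λ d z q → (d ⊕ z) ⊕ q ⊜ (d ⊕ q) ⊕ z) ≈-refl (ev (X₁₄ ∙ X₂₃)) (ev X₃₂) q ⟩
          ev (X₁₄ ∙ X₂₃) * q * ev X₃₂              ≈⟨ ∙-congʳ (ev-÷ (X H₁ a₃ ∙ X H₂ a₄) (X₁₄ ∙ X₂₃)) ⟩
          ev (X H₁ a₃ ∙ X H₂ a₄) * ev X₃₂          ≈⟨ ∙-congʳ (ev-∙ (X H₁ a₃) (X H₂ a₄)) ⟩
          value H₁ a₃ * value H₂ a₄ * value H₃ a₂  ∎)
        , (begin
          ev (X₁₄ ∙ X₂₃ ∙ X₃₂) * r                 ≈⟨ ∙-congʳ (ev-∙∙ X₁₄ X₂₃ X₃₂) ⟩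
          ev X₁₄ * ev X₂₃ * ev X₃₂ * r             ≈⟨ solve 4 (λ d y z r → ((d ⊕ y) ⊕ z) ⊕ r ⊜ ((d ⊕ z) ⊕ r) ⊕ y) ≈-refl (ev X₁₄) (ev X₂₃) (ev X₃₂) r ⟩
          ev X₁₄ * ev X₃₂ * r * ev X₂₃             ≈⟨ ∙-congʳ (∙-congʳ (ev-∙ X₁₄ X₃₂)) ⟨
          ev (X₁₄ ∙ X₃₂) * r * ev X₂₃              ≈⟨ ∙-congʳ (ev-÷ (X H₁ a₂ ∙ X H₃ a₄) (X₁₄ ∙ X₃₂)) ⟩
          ev (X H₁ a₂ ∙ X H₃ a₄) * ev X₂₃          ≈⟨ ∙-congʳ (ev-∙ (X H₁ a₂) (X H₃ a₄)) ⟩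
          value H₁ a₂ * value H₃ a₄ * value H₂ a₃  ∎)
        , (begin
          ev (X₁₄ ∙ X₂₃ ∙ X₃₂) * Φg.⟦ negᶠ 1ᶠ ⟧        ≈⟨ ∙-congˡ (Φg.-‿homo 1ᶠ) ⟩
          ev (X₁₄ ∙ X₂₃ ∙ X₃₂) * - ev 1ᵐ               ≈⟨ *-‿distribʳ _ _ ⟨
          - (ev (X₁₄ ∙ X₂₃ ∙ X₃₂) * ev 1ᵐ)             ≈⟨ -‿cong (≈-trans (ev-1 _) (ev-∙∙ X₁₄ X₂₃ X₃₂)) ⟩
          - (value H₁ a₄ * value H₂ a₃ * value H₃ a₂)  ∎)
        where
        X₁₄ X₂₃ X₃₂ : Monomial _
        X₁₄ = X H₁ a₄
        X₂₃ = X H₂ a₃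
        X₃₂ = X H₃ a₂
        q r : Carrier
        q = ev ((X H₁ a₃ ∙ X H₂ a₄) ÷ (X₁₄ ∙ X₂₃))
        r = ev ((X H₁ a₂ ∙ X H₃ a₄) ÷ (X₁₄ ∙ X₃₂))

    satisfiesT⇒respects : SatisfiesT P value → Respects P (T M F?) g
    satisfiesT⇒respects sat (T₁ H₁ H₂ H₃ H! modular {a₁} {a₂} {a₃} a₁∈ a₂∈ a₃∈) =
      let p , q = T₁-value H₁ H₂ H₃ a₁ a₂ a₃ in
      Null-cancel (ev≉0 (X H₁ a₃ ∙ X H₂ a₁ ∙ X H₃ a₂)) (Null-resp (≈-sym p) (≈-sym q) (≈-sym (zeroʳ _))
        (SatisfiesT.T₁-cleared sat H₁ H₂ H₃ H! modular a₁∈ a₂∈ a₃∈))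
    satisfiesT⇒respects sat (T₂ H₁ H₂ H₃ H₄ H! modular {a₁} {a₂} {a₃} {a₄} a₁∈ a₂∈ a₃∈ a₄∈) =
      let p , q , r = T₂-value H₁ H₂ H₃ a₂ a₃ a₄ in
      Null-cancel (ev≉0 (X H₁ a₄ ∙ X H₂ a₃ ∙ X H₃ a₂)) (Null-resp (≈-sym p) (≈-sym q) (≈-sym r)
        (SatisfiesT.T₂-cleared sat H₁ H₂ H₃ H₄ H! modular a₁∈ a₂∈ a₃∈ a₄∈))

    respects⇒satisfiesT : Respects P (T M F?) g → SatisfiesT P value
    respects⇒satisfiesT resp .SatisfiesT.T₁-cleared H₁ H₂ H₃ H! modular {a₁} {a₂} {a₃} a₁∈ a₂∈ a₃∈ =
      let p , q = T₁-value H₁ H₂ H₃ a₁ a₂ a₃ in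
      Null-resp p q (zeroʳ _) (Null-* (ev (X H₁ a₃ ∙ X H₂ a₁ ∙ X H₃ a₂)) (resp (T₁ H₁ H₂ H₃ H! modular a₁∈ a₂∈ a₃∈)))
    respects⇒satisfiesT resp .SatisfiesT.T₂-cleared H₁ H₂ H₃ H₄ H! modular {a₁} {a₂} {a₃} {a₄} a₁∈ a₂∈ a₃∈ a₄∈ =
      let p , q , r = T₂-value H₁ H₂ H₃ a₂ a₃ a₄ in
      Null-resp p q r (Null-* (ev (X H₁ a₄ ∙ X H₂ a₃ ∙ X H₃ a₂)) (resp (T₂ H₁ H₂ H₃ H₄ H! modular a₁∈ a₂∈ a₃∈ a₄∈)))

    value≉0 : ∀ H e → value H e ≉ 0#
    value≉0 H e = ev≉0 (X H e)

    value-lookup : ∀ i → value (proj₁ (lookup (S M F?) i)) (proj₂ (lookup (S M F?) i)) ≈ proj₁ (g i)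
    value-lookup i = ≈-trans (≈-reflexive (cong ev (x-lookup i))) (power-basis unitGroup g i)

    value-forest : ∀ {H e} → (H , e) ∈ᴾ F → value H e ≈ 1#
    value-forest He∈F = ≈-trans (≈-reflexive (cong ev (x-forest He∈F))) Φg.1-homo

-- Normalized representations

module _ {M : Matroid n} {P : Pasture c ℓ ν} where
  open Pasture P
  open CommutativeMonoidSolver commutativeMonoid using (solve; _⊜_; _⊕_)
  open SetoidReasoning setoid
  open Representation

  -- A dependency survives: a_H is absorbed into the coefficient of `H`, and t_e is a common factor
  -- of the three terms at `e`.
  rescale : (Hyperplane M → Unit) → (Fin n → Unit) → Representation M P → Representation M P
  rescale a t R = record
    { φ = λ H e → proj₁ (a H) * proj₁ (t e) * φ R H e
    ; φ-zero = λ H e → mk⇔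
        (λ atφ≈0 → ∈-stable H e λ e∉H → *-nonzero (*-nonzero (proj₂ (a H)) (proj₂ (t e))) (φ≉0 P R e∉H) atφ≈0)
        (λ e∈H → ≈-trans (∙-congˡ (φ≈0 P R e∈H)) (zeroʳ _))
    ; φ-modular = λ H₁ H₂ H₃ H! modular → let b₁ , b₂ , b₃ , b≉0 , N = φ-modular R H₁ H₂ H₃ H! modular in
        b₁ * a⁻¹ H₁ , b₂ * a⁻¹ H₂ , b₃ * a⁻¹ H₃
        , (λ (p , q , r) → b≉0 (cancel-a H₁ p , cancel-a H₂ q , cancel-a H₃ r))
        , λ e → Null-resp (regroup H₁ e) (regroup H₂ e) (regroup H₃ e) (Null-* (proj₁ (t e)) (N e)) }
    where
    ∈-stable : ∀ H e → ¬ (e ∉ set H) → e ∈ set H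
    ∈-stable H e = decidable-stable (e Subset.∈? set H)
    a⁻¹ : Hyperplane M → Carrier
    a⁻¹ H = proj₁ (a H ⁻¹)
    cancel-a : ∀ H {b} → b * a⁻¹ H ≈ 0# → b ≈ 0#
    cancel-a H p = PastureProperties.*-cancelˡ P (proj₂ (a H ⁻¹)) (≈-trans (comm _ _) (≈-trans p (≈-sym (zeroʳ _))))
    regroup : ∀ H e {b} → proj₁ (t e) * (b * φ R H e) ≈ b * a⁻¹ H * (proj₁ (a H) * proj₁ (t e) * φ R H e)
    regroup H e {b} = begin
      proj₁ (t e) * (b * φ R H e)
        ≈⟨ identityˡ _ ⟨
      1# * (proj₁ (t e) * (b * φ R H e))
        ≈⟨ ∙-congʳ (unitInverseʳ (a H)) ⟨
      proj₁ (a H) * a⁻¹ H * (proj₁ (t e) * (b * φ R H e))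
        ≈⟨ solve 5 (λ h i t b f → (h ⊕ i) ⊕ (t ⊕ (b ⊕ f)) ⊜ (b ⊕ i) ⊕ ((h ⊕ t) ⊕ f)) ≈-refl (proj₁ (a H)) (a⁻¹ H) (proj₁ (t e)) b (φ R H e) ⟩
      b * a⁻¹ H * (proj₁ (a H) * proj₁ (t e) * φ R H e) ∎

module _ {M : Matroid n} {P : Pasture c ℓ ν} {Q : Pasture c′ ℓ′ ν′} (g : Morphism P Q) where
  open Morphism g

  push-cong : {R R′ : Representation M P} → RescalingEquivalent M P R R′ →
              RescalingEquivalent M Q (push g R) (push g R′)
  push-cong (a , t , p) = ⟦_⟧ᵘ ∘ a , ⟦_⟧ᵘ ∘ t , λ H e →
    Q.≈-trans (⟦⟧-cong (p H e)) (Q.≈-trans (*-homo _ _) (Q.∙-congʳ (*-homo _ _)))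
    where module Q = Pasture Q

module _ {M : Matroid n} {F : EdgeSet M} (F? : Decidable F) (spanning : IsSpanningForest M F) where
  open IsSpanningForest spanning
  open Representation

  private
    -- `labelling` and `potential` proceed by induction on a list of edges, so `F` is enumerated.
    forestEdges : List (Hyperplane M × Fin n)
    forestEdges = filter F? (cartesianProduct (hyperplanes M) (allFin n))

    F⊆forestEdges : F ⊆ᴾ (_∈ˡ forestEdges)
    F⊆forestEdges {H , e} = ∈-filter⁺ F? (∈-cartesianProduct⁺ (∈-hyperplanes M H) (∈-allFin e))

    forestEdges⊆F : (_∈ˡ forestEdges) ⊆ᴾ F
    forestEdges⊆F He∈ = proj₂ (∈-filter⁻ F? {xs = cartesianProduct (hyperplanes M) (allFin n)} He∈)

    connected : ∀ {H e} → e ∉ set H → Star (Adjacent F) (inj₁ H) (inj₂ e)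
    connected = spanning⇒connected spanning (labelling-resp forestEdges⊆F F⊆forestEdges (labelling forestEdges))

    S-edge : Fin (length (S M F?)) → Hyperplane M × Fin n
    S-edge = lookup (S M F?)

    S-edge-∉ : ∀ i → proj₂ (S-edge i) ∉ set (proj₁ (S-edge i))
    S-edge-∉ i = proj₁ (∈-S⁻ F? (∈-lookup i))

  module _ (P : Pasture c ℓ ν) where
    open Pasture P
    open SetoidReasoning setoid
    private
      module U = AbelianGroup unitGroup
      module UP = AbelianGroupProperties unitGroup
      module Reps = Setoid (RepresentationClasses M P)

    Normalized : Representation M P → Set _
    Normalized R = ∀ {H e} → (H , e) ∈ᴾ F → φ R H e ≈ 1#

    -- On an edge of `F` both values are 1, so a_H = t_e⁻¹. The function with values a_H and t_e⁻¹
    -- is thus constant along walks in `F`, and these join the ends of every edge of the incidence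
    -- graph.
    normalized-unique : ∀ {R R′} → Normalized R → Normalized R′ → RescalingEquivalent M P R R′ →
                        ∀ H e → φ R H e ≈ φ R′ H e
    normalized-unique {R} {R′} norm norm′ (a , t , p) H e with e Subset.∈? set H
    ... | yes e∈H = ≈-trans (φ≈0 P R e∈H) (≈-sym (φ≈0 P R′ e∈H))
    ... | no  e∉H = begin
      φ R H e                                ≈⟨ identityˡ _ ⟨
      1# * φ R H e                           ≈⟨ ∙-congʳ at≈1 ⟨
      proj₁ (a H) * proj₁ (t e) * φ R H e    ≈⟨ p H e ⟨
      φ R′ H e                               ∎
      where
      scaling : Vertex M → U.Carrier
      scaling (inj₁ H) = a H
      scaling (inj₂ e) = t e ⁻¹
      scaling-edge : ∀ {H e} → (H , e) ∈ᴾ F → a H U.≈ t e ⁻¹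
      scaling-edge {H} {e} He∈F = UP.inverseˡ-unique (a H) (t e) (begin
        proj₁ (a H) * proj₁ (t e)              ≈⟨ identityʳ _ ⟨
        proj₁ (a H) * proj₁ (t e) * 1#         ≈⟨ ∙-congˡ (norm He∈F) ⟨
        proj₁ (a H) * proj₁ (t e) * φ R H e    ≈⟨ p H e ⟨
        φ R′ H e                               ≈⟨ norm′ He∈F ⟩
        1#                                     ∎)
      scaling-adjacent : ∀ {v w} → Adjacent F v w → scaling v U.≈ scaling w
      scaling-adjacent (forwards He∈F)  = scaling-edge He∈F
      scaling-adjacent (backwards He∈F) = ≈-sym (scaling-edge He∈F)
      at≈1 : proj₁ (a H) * proj₁ (t e) ≈ 1#
      at≈1 = ≈-trans (∙-congʳ (Star.fold (λ v w → scaling v U.≈ scaling w)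
        (λ a p → ≈-trans (scaling-adjacent a) p) ≈-refl (connected e∉H))) (U.inverseˡ (t e))

    normalized-determined : ∀ {R R′} → Normalized R → Normalized R′ →
      (∀ i → φ R (proj₁ (S-edge i)) (proj₂ (S-edge i)) ≈ φ R′ (proj₁ (S-edge i)) (proj₂ (S-edge i))) →
      RescalingEquivalent M P R R′
    normalized-determined {R} {R′} norm norm′ equal = (λ _ → U.ε) , (λ _ → U.ε) , λ H e →
      ≈-trans (≈-sym (φ≈ H e)) (≈-sym (≈-trans (∙-congʳ (identityˡ 1#)) (identityˡ _)))
      where
      φ≈ : ∀ H e → φ R H e ≈ φ R′ H e
      φ≈ H e with e Subset.∈? set H
      ... | yes e∈H = ≈-trans (φ≈0 P R e∈H) (≈-sym (φ≈0 P R′ e∈H))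
      ... | no e∉H with edge-cases F? {H} {e} e∉H
      ...   | inj₁ (i , refl) = equal i
      ...   | inj₂ He∈F = ≈-trans (norm He∈F) (≈-sym (norm′ He∈F))

    private
      weight : Representation M P → Hyperplane M → Fin n → U.Carrier
      weight R H e with e Subset.∈? set H
      -- A default that keeps the weight in the unit group; edges of `F` always fall under the other
      -- case.
      ... | yes _  = U.ε
      ... | no e∉H = φ R H e , φ≉0 P R e∉H

      weight-edge : ∀ R {H e} → e ∉ set H → proj₁ (weight R H e) ≈ φ R H e
      weight-edge R {H} {e} e∉H with e Subset.∈? set H
      ... | yes e∈H = contradiction e∈H e∉H
      ... | no _    = ≈-refl

      forestPotential : ∀ R → Potential unitGroup (weight R) (_∈ˡ forestEdges)
      forestPotential R = potential unitGroup (weight R) forestEdges (acyclic-antimono forestEdges⊆F acyclic)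

      a-scale : Representation M P → Hyperplane M → U.Carrier
      a-scale R H = proj₁ (forestPotential R) (inj₁ H)

      t-scale : Representation M P → Fin n → U.Carrier
      t-scale R e = proj₁ (forestPotential R) (inj₂ e) ⁻¹

    normalize : Representation M P → Representation M P
    normalize R = rescale (a-scale R) (t-scale R) R

    normalize-∼ : ∀ R → RescalingEquivalent M P R (normalize R)
    normalize-∼ R = a-scale R , t-scale R , λ H e → ≈-refl

    normalize-normalized : ∀ R → Normalized (normalize R)
    normalize-normalized R {H} {e} He∈F = begin
      proj₁ (p (inj₁ H)) * proj₁ (p (inj₂ e) ⁻¹) * φ R H e    ≈⟨ assoc _ _ _ ⟩
      proj₁ (p (inj₁ H)) * (proj₁ (p (inj₂ e) ⁻¹) * φ R H e)  ≈⟨ ∙-congˡ (comm _ _) ⟩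
      proj₁ (p (inj₁ H)) * (φ R H e * proj₁ (p (inj₂ e) ⁻¹))  ≈⟨ assoc _ _ _ ⟨
      proj₁ (p (inj₁ H)) * φ R H e * proj₁ (p (inj₂ e) ⁻¹)    ≈⟨ ∙-congʳ (∙-congˡ (weight-edge R (edges He∈F))) ⟨
      proj₁ (p (inj₁ H) U.∙ weight R H e) * proj₁ (p (inj₂ e) ⁻¹)
                                                              ≈⟨ ∙-congʳ (proj₂ (forestPotential R) (F⊆forestEdges He∈F)) ⟨
      proj₁ (p (inj₂ e)) * proj₁ (p (inj₂ e) ⁻¹)              ≈⟨ unitInverseʳ (p (inj₂ e)) ⟩
      1#                                                      ∎
      where
      p : Vertex M → U.Carrier
      p = proj₁ (forestPotential R)

    normalize-unique : ∀ {R R′} → RescalingEquivalent M P R R′ → Normalized R′ →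
                       ∀ H e → φ (normalize R) H e ≈ φ R′ H e
    normalize-unique {R} {R′} R∼R′ norm′ = normalized-unique {normalize R} {R′} (normalize-normalized R) norm′
      (Reps.trans {normalize R} {R} {R′} (Reps.sym {R} {normalize R} (normalize-∼ R)) R∼R′)

    coordinates : Representation M P → Fin (length (S M F?)) → Unit
    coordinates R i = φ R (proj₁ (S-edge i)) (proj₂ (S-edge i)) , φ≉0 P R (S-edge-∉ i)

    coordinates-value : ∀ {R} → Normalized R → ∀ {H e} → e ∉ set H → φ R H e ≈ value F? P (coordinates R) H e
    coordinates-value {R} norm {H} {e} e∉H with edge-cases F? {H} {e} e∉H
    ... | inj₁ (i , refl) = ≈-sym (value-lookup F? P (coordinates R) i)
    ... | inj₂ He∈F = ≈-trans (norm He∈F) (≈-sym (value-forest F? P (coordinates R) He∈F))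

    -- Representations and solutions

    Sol : Setoid _ _
    Sol = Solutions P (T M F?)

    solution : Representation M P → Setoid.Carrier Sol
    solution R = coordinates (normalize R) , satisfiesT⇒respects F? P (coordinates (normalize R))
      (satisfiesT-resp P (λ {H} {e} → coordinates-value {normalize R} (normalize-normalized R) {H} {e})
        (representation⇒T P (normalize R)))

    private
      module _ (s : Setoid.Carrier Sol) where
        value₀ : Hyperplane M → Fin n → Carrier
        value₀ H e with e Subset.∈? set H
        ... | yes _ = 0#
        ... | no _  = value F? P (proj₁ s) H e

        value₀-∉ : ∀ {H e} → e ∉ set H → value₀ H e ≈ value F? P (proj₁ s) H e
        value₀-∉ {H} {e} e∉H with e Subset.∈? set H
        ... | yes e∈H = contradiction e∈H e∉H
        ... | no _    = ≈-refl

        value₀-zero : ∀ H e → value₀ H e ≈ 0# ⇔ e ∈ set H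
        value₀-zero H e with e Subset.∈? set H
        ... | yes e∈H = mk⇔ (λ _ → e∈H) (λ _ → ≈-refl)
        ... | no e∉H  = mk⇔ (λ v≈0 → contradiction v≈0 (value≉0 F? P (proj₁ s) H e)) (λ e∈H → contradiction e∈H e∉H)

    fromSolution : Setoid.Carrier Sol → Representation M P
    fromSolution s@(g , resp) = T⇒representation P (value₀-zero s)
      (satisfiesT-resp P (λ e∉H → ≈-sym (value₀-∉ s e∉H)) (respects⇒satisfiesT F? P g resp))

    fromSolution-normalized : ∀ s → Normalized (fromSolution s)
    fromSolution-normalized s@(g , _) He∈F = ≈-trans (value₀-∉ s (edges He∈F)) (value-forest F? P g He∈F)

    representations⤖solutions : Bijection (RepresentationClasses M P) Sol
    representations⤖solutions = record
      { to = solution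
      ; cong = λ {R} {R′} R∼R′ i → normalize-unique {R} {normalize R′}
          (Reps.trans {R} {R′} {normalize R′} R∼R′ (normalize-∼ R′)) (normalize-normalized R′) _ _
      ; bijective =
          -- Injectivity: the normal forms agree on S by assumption and on `F` by normalization.
          (λ {R} {R′} s≈s′ → Reps.trans {R} {normalize R} {R′} (normalize-∼ R)
            (Reps.trans {normalize R} {normalize R′} {R′}
              (normalized-determined {normalize R} {normalize R′} (normalize-normalized R) (normalize-normalized R′) s≈s′)
              (Reps.sym {R′} {normalize R′} (normalize-∼ R′))))
        -- Surjectivity: `fromSolution s` is normalized already, so normalizing leaves its values
        -- unchanged.
        , λ s → fromSolution s , λ {R} R∼s i → ≈-trans
            (normalize-unique {R} {fromSolution s} R∼s (fromSolution-normalized s) _ _)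
            (≈-trans (value₀-∉ s (S-edge-∉ i)) (value-lookup F? P (proj₁ s) i)) }

  -- A morphism preserves 1 and rescaling equivalence, so it takes the normal form of `R` to a
  -- normalized representation equivalent to `push g R`; uniqueness identifies this with the normal
  -- form of `push g R`.
  solution-natural : {P : Pasture c ℓ ν} {Q : Pasture c′ ℓ′ ν′} (g : Morphism P Q) (R : Representation M P) → ∀ i →
    Pasture._≈_ Q (proj₁ (proj₁ (solution Q (push g R)) i)) (Morphism.⟦ g ⟧ (proj₁ (proj₁ (solution P R) i)))
  solution-natural {P = P} {Q} g R i = normalize-unique Q {push g R} {push g (normalize P R)}
    (push-cong g {R} {normalize P R} (normalize-∼ P R))
    (λ He∈F → Pasture.≈-trans Q (Morphism.⟦⟧-cong g (normalize-normalized P R He∈F)) (Morphism.1-homo g)) _ _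

  -- Passage to morphisms and functoriality

  module _ (P : Pasture c ℓ ν) where
    solutions↔morphisms : Inverse (Hom (Quotient (T M F?) (T-admissible M F?)) P) (Sol P)
    solutions↔morphisms = Bijection⇒Inverse (universalProperty P (T M F?) (T-admissible M F?))

    representations⤖morphisms : Bijection (RepresentationClasses M P) (Hom (Quotient (T M F?) (T-admissible M F?)) P)
    representations⤖morphisms = Composition.bijection (representations⤖solutions P)
      (Inverse⇒Bijection (inverse-sym solutions↔morphisms))

    -- Describes the morphism attached to `R` by its values at the indeterminates, which are the
    -- coordinates of the normal form of `R`.
    restrict-to : ∀ R → Setoid._≈_ (Sol P)
      (restrict P (T M F?) (T-admissible M F?) (Bijection.to representations⤖morphisms R))
      (solution P R)
    restrict-to R = Inverse.strictlyInverseˡ solutions↔morphisms (solution P R)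

theorem2p23 : ∀ {n} (M : Matroid n) {F : EdgeSet M} (F? : Decidable F) → IsSpanningForest M F →
    ∀ {c ℓ ν} →
    Σ[ β ∈ ((P : Pasture c ℓ ν) → Bijection (RepresentationClasses M P) (Hom (Quotient (T M F?) (T-admissible M F?)) P)) ]
    (∀ {P Q : Pasture c ℓ ν} (g : Morphism P Q) (R : Representation M P) →
    Setoid._≈_ (Hom (Quotient (T M F?) (T-admissible M F?)) Q)
    (Bijection.to (β Q) (push g R))
    (g ∘ᴹ Bijection.to (β P) R))
theorem2p23 M F? spanning = representations⤖morphisms F? spanning , λ {P} {Q} g R →
  let module Q = Pasture Q
      β = representations⤖morphisms F? spanning in
  -- Morphisms out of the quotient are determined by their values at the indeterminates, so
  -- naturality needs checking only there.
  Bijection.injective (universalProperty Q (T M F?) (T-admissible M F?))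
    {Bijection.to (β Q) (push g R)} {g ∘ᴹ Bijection.to (β P) R}
    λ i → Q.≈-trans (restrict-to F? spanning Q (push g R) i)
      (Q.≈-trans (solution-natural F? spanning {P = P} {Q} g R i)
        (Morphism.⟦⟧-cong g (Pasture.≈-sym P (restrict-to F? spanning P R i))))
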